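{- There is an algorithm that decides, for every finite BSR(SLR) clause set, whether it is satisfiable.
   Context: Two-sorted hierarchic setting: a base sort $\mathcal{R}$, always interpreted as $\mathbb{R}$ with its standard arithmetic, and a free sort $\mathcal{S}$. There are countably many base-sort variables and free-sort variables. Linear arithmetic (LA) terms are built with $+$ and $-$ from rational constants, base-sort variables, and base-sort Skolem constants (constant symbols of sort $\mathcal{R}$ whose real value is chosen by the interpretation). There is a finite set of free-sort constant symbols, a finite set of predicate symbols, each with a sort $\xi_1\times\dots\times\xi_k$ with $\xi_i\in\{\mathcal{R},\mathcal{S}\}$, and a built-in equality $\approx$ on $\mathcal{S}$. A BSR(SLR) clause has the form $\Lambda\,\|\,\Gamma\to\Delta$, where $\Lambda,\Gamma,\Delta$ are finite multisets of atoms such that: every atom of $\Lambda$ has the form $s\triangleleft t$, $x\triangleleft t$, or $x\triangleleft y$, where $s,t$ are ground (variable-free) LA terms, $x,y$ are base-sort variables and $\triangleleft\in\{<,\le,=,\ne,\ge,>\}$; every atom of $\Gamma$ and $\Delta$ is either an equation $s\approx s'$ between free-sort variables or free-sort constants, or a well-sorted atom $P(s_1,\dots,s_k)$ whose arguments are base-sort variables, free-sort variables or free-sort constants. The clause stands for the universal closure of $(\bigwedge\Lambda\wedge\bigwedge\Gamma)\to\bigvee\Delta$ (empty $\Delta$ means falsity). An interpretation $\mathcal{A}$ interprets $\mathcal{R}$ as $\mathbb{R}$, assigns a real number to each base-sort Skolem constant, chooses a nonempty set $\mathcal{S}^{\mathcal{A}}$, an element of $\mathcal{S}^{\mathcal{A}}$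 for each free-sort constant, and a relation $P^{\mathcal{A}}\subseteq\xi_1^{\mathcal{A}}\times\dots\times\xi_k^{\mathcal{A}}$ for each predicate symbol $P$; LA terms and constraints are evaluated in the standard way. $\mathcal{A}$ is a model of a clause if the clause holds in $\mathcal{A}$ under every sort-respecting variable assignment, and a model of a clause set if it is a model of every clause in it. A clause set is satisfiable if it has a model. -}

module Defs where

open import Level using (Level; 0ℓ) renaming (suc to lsuc)
open import Data.Nat using (ℕ)
open import Data.Fin using (Fin)
open import Data.Bool using (Bool)
open import Data.List using (List; _∷_)
open import Data.List.Relation.Unary.All using (All)
open import Data.List.Relation.Unary.Any using (Any)
open import Data.Product using (Σ; _×_; ∃)
open import Data.Sum using (_⊎_)
open import Relation.Nullary using (¬_)
open import Relation.Binary.PropositionalEquality using (_≡_)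
open import Relation.Binary.Structures using (IsStrictTotalOrder)
open import Algebra.Structures using (IsCommutativeRing)
import Data.Rational as ℚ
open ℚ using (ℚ)

-- The real numbers, axiomatised as a (Dedekind-)complete ordered field.
-- Any two such structures are isomorphic, so quantifying over all of them
-- is the same as fixing ℝ.  The order is strict-total, hence trichotomous
-- (classically true of ℝ).  ι is the (unique) ring embedding of ℚ, used to
-- interpret rational constants.

record RealField : Set₁ where
  infixl 6 _+_ _-_
  infixl 7 _*_
  infix 4 _<_ _≤_
  field
    Carrier : Set
    _+_ _*_ : Carrier → Carrier → Carrier
    -_      : Carrier → Carrier
    0r 1r   : Carrier
    _<_     : Carrier → Carrier → Set
    isCommutativeRing : IsCommutativeRing _≡_ _+_ _*_ -_ 0r 1r
    0≢1      : ¬ (0r ≡ 1r)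
    inverse  : ∀ x → ¬ (x ≡ 0r) → Σ Carrier (λ y → x * y ≡ 1r)
    isStrictTotalOrder : IsStrictTotalOrder _≡_ _<_
    +-mono-< : ∀ {x y} z → x < y → x + z < y + z
    *-pos    : ∀ {x y} → 0r < x → 0r < y → 0r < x * y
  _-_ : Carrier → Carrier → Carrier
  x - y = x + (- y)
  _≤_ : Carrier → Carrier → Set
  x ≤ y = (x < y) ⊎ (x ≡ y)
  IsUpperBound : (Carrier → Set) → Carrier → Set
  IsUpperBound P b = ∀ x → P x → x ≤ b
  field
    complete : (P : Carrier → Set) → ∃ P → ∃ (IsUpperBound P) →
               Σ Carrier (λ s → IsUpperBound P s × (∀ b → IsUpperBound P b → s ≤ b))
    ι        : ℚ → Carrier
    ι-+      : ∀ p q → ι (p ℚ.+ q) ≡ ι p + ι q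
    ι-*      : ∀ p q → ι (p ℚ.* q) ≡ ι p * ι q
    ι-1      : ι ℚ.1ℚ ≡ 1r

data Sort : Set where
  base free : Sort

-- finite signature: free-sort constants Fin nConst, predicates Fin nPred
record Signature : Set where
  field
    nConst : ℕ
    nPred  : ℕ
    arity  : Fin nPred → List Sort
open Signature public

-- base-sort variables and base-sort Skolem constants are indexed by ℕ;
-- free-sort variables are indexed by ℕ.

data GTerm : Set where
  num   : ℚ → GTerm
  skol  : ℕ → GTerm
  _⊕_   : GTerm → GTerm → GTerm
  _⊖_   : GTerm → GTerm → GTerm

data Rel : Set where
  lt le eq ne ge gt : Rel

data Constraint : Set where
  gg : GTerm → Rel → GTerm → Constraint
  vg : ℕ → Rel → GTerm → Constraint
  vv : ℕ → Rel → ℕ → Constraint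

module _ (σ : Signature) where

  data FTerm : Set where
    fvar   : ℕ → FTerm
    fconst : Fin (nConst σ) → FTerm

  Arg : Sort → Set
  Arg base = ℕ          -- base-sort variable
  Arg free = FTerm

  data Atom : Set where
    _≈ₐ_ : FTerm → FTerm → Atom
    pred : (p : Fin (nPred σ)) → All Arg (arity σ p) → Atom

  -- Λ ‖ Γ → Δ   (multisets represented as lists)
  record Clause : Set where
    constructor _‖_⇒_
    field
      Λ : List Constraint
      Γ : List Atom
      Δ : List Atom

module Semantics (R : RealField) (σ : Signature) where
  open RealField R

  sortDom : Set → Sort → Set
  sortDom S base = Carrier
  sortDom S free = S

  record Interpretation : Set₁ where
    field
      skolemI : ℕ → Carrier
      S       : Set
      inhabit : S
      constI  : Fin (nConst σ) → S
      predI   : (p : Fin (nPred σ)) → All (sortDom S) (arity σ p) → Set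
    ⟦_⟧ˢ : Sort → Set
    ⟦_⟧ˢ = sortDom S

  module _ (𝒜 : Interpretation) where
    open Interpretation 𝒜

    evalG : GTerm → Carrier
    evalG (num q)  = ι q
    evalG (skol k) = skolemI k
    evalG (s ⊕ t)  = evalG s + evalG t
    evalG (s ⊖ t)  = evalG s - evalG t

    holdsRel : Rel → Carrier → Carrier → Set
    holdsRel lt a b = a < b
    holdsRel le a b = a ≤ b
    holdsRel eq a b = a ≡ b
    holdsRel ne a b = ¬ (a ≡ b)
    holdsRel ge a b = b ≤ a
    holdsRel gt a b = b < a

    module _ (βb : ℕ → Carrier) (βf : ℕ → S) where

      evalC : Constraint → Set
      evalC (gg s r t) = holdsRel r (evalG s) (evalG t)
      evalC (vg x r t) = holdsRel r (βb x) (evalG t)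
      evalC (vv x r y) = holdsRel r (βb x) (βb y)

      evalF : FTerm σ → S
      evalF (fvar x)   = βf x
      evalF (fconst c) = constI c

      evalArgs : ∀ {ss} → All (Arg σ) ss → All ⟦_⟧ˢ ss
      evalArgs All.[] = All.[]
      evalArgs {base ∷ _} (x All.∷ as) = βb x All.∷ evalArgs as
      evalArgs {free ∷ _} (t All.∷ as) = evalF t All.∷ evalArgs as

      evalA : Atom σ → Set
      evalA (s ≈ₐ t)    = evalF s ≡ evalF t
      evalA (pred p as) = predI p (evalArgs as)

    ModelOfClause : Clause σ → Set
    ModelOfClause (Λ ‖ Γ ⇒ Δ) =
      ∀ (βb : ℕ → Carrier) (βf : ℕ → S) →
        All (evalC βb βf) Λ → All (evalA βb βf) Γ → Any (evalA βb βf) Δ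

    Model : List (Clause σ) → Set
    Model N = All ModelOfClause N

  Satisfiable : List (Clause σ) → Set₁
  Satisfiable N = Σ Interpretation (λ 𝒜 → Model 𝒜 N)

{-# OPTIONS --safe #-}
-- Evaluating the ground terms of N cuts ℝ into finitely many thresholds and open gaps. Call an interpretation uniform
-- if its free sort consists of (at most one element besides) the constants and the truth of P(r̄, s̄) depends only on s̄,
-- on the positions of the reals r̄ among the thresholds and on their relative order. Whether there is a uniform model is
-- a finite question once the order of the ground terms is guessed, and Fourier–Motzkin elimination decides which orders
-- are realised by some values of the Skolem constants.
--
-- Conversely, every model yields a uniform one. Fix an increasing sequence of reals in every gap and colour tuples of
-- indices by the atoms that hold at the corresponding points. On a large set H of indices homogeneous for all these
-- colourings, let the first K elements of H index the points used in the first gap, the next K those in the second, and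
-- so on: then truth at these points depends only on positions and on the order within each gap.
--
-- Completeness of ℝ makes every negated proposition decidable, so the model may be taken two-valued up to ¬¬.

module Submission where

open import Defs
open import Data.Bool using (Bool; true)
open import Data.List using (List)
open import Data.Product using (Σ)
open import Relation.Binary.PropositionalEquality using (_≡_)
open import Function.Bundles using (_⇔_)

open import Algebra.Bundles using (CommutativeRing)
import Algebra.Properties.Group
import Algebra.Solver.Ring
open import Algebra.Solver.Ring.AlmostCommutativeRing using (fromCommutativeRing; _-Raw-AlmostCommutative⟶_)
open import Data.Bool using (false; if_then_else_; not; _∧_; _∨_)
import Data.Bool as Bool
open import Data.Bool.ListAction using (all; any)
open import Data.Fin as Fin using (Fin)
open import Data.Integer as ℤ using (-[1+_])
import Data.Integer.Properties as ℤₚ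
open import Data.List using ([]; _∷_; _++_; length; map; concatMap; zipWith; cartesianProduct; cartesianProductWith; upTo; allFin)
open import Data.List.Extrema.Nat using (max; xs≤max)
open import Data.List.Membership.Propositional using (_∈_; lose; find)
open import Data.List.Membership.Propositional.Properties
  using ( ∈-map⁺; ∈-map⁻; ∈-++⁺ˡ; ∈-++⁺ʳ; ∈-upTo⁺; ∈-upTo⁻; ∈-allFin; ∈-concatMap⁺; ∈-cartesianProduct⁺; ∈-cartesianProduct⁻
        ; ∈-cartesianProductWith⁺; ∈-cartesianProductWith⁻)
import Data.List.Properties as Listₚ
open import Data.List.Relation.Unary.All as All using (All; []; _∷_)
import Data.List.Relation.Unary.All.Properties as Allₚ
open import Data.List.Relation.Unary.AllPairs using (AllPairs; []; _∷_)
import Data.List.Relation.Unary.AllPairs.Properties as AllPairsₚ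
open import Data.List.Relation.Unary.Any as Any using (Any; here; there)
import Data.Maybe as Maybe
open import Data.Nat as ℕ using (ℕ; zero; suc; _⊔_; z≤n; s≤s)
open import Data.Nat.Coprimality using (Coprime)
import Data.Nat.Properties as ℕₚ
open import Data.Product using (∃; _×_; _,_; proj₁; proj₂)
import Data.Product.Properties as Productₚ
open import Data.Rational as ℚ using (ℚ; mkℚ; 0ℚ; 1ℚ; ½; toℚᵘ)
import Data.Rational.Properties as ℚₚ
open import Data.Rational.Unnormalised as ℚᵘ using (mkℚᵘ; *≡*)
import Data.Rational.Unnormalised.Properties as ℚᵘₚ
open import Data.Sum using (_⊎_; inj₁; inj₂)
open import Function using (_∘_; id; mk⇔)
open import Level using (0ℓ)
open import Relation.Binary.Definitions using (DecidableEquality; Tri; tri<; tri≈; tri>)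
open import Relation.Binary.PropositionalEquality
  using (refl; sym; trans; cong; cong₂; subst; subst₂; module ≡-Reasoning)
open import Relation.Binary.Structures using (IsStrictTotalOrder)
open import Relation.Nullary using (¬_; Dec; yes; no; does; contradiction)
open import Relation.Nullary.Decidable using (map′; _×-dec_; dec⇒maybe; dec-true; decidable-stable)

-- The base sort is always all of ℝ, so a model cannot be cut down to finitely many sample points.
-- Instead, truth at the samples is copied to every tuple of reals with the same positions and
-- relative order; a clause survives because each real assignment is imitated, on the variables of
-- the clause, by an abstract one. The free sort can be cut down, since clauses are universal and
-- there are no function symbols on it. Homogeneity gives invariance only under the full order type
-- of the index tuple, including comparisons between indices used in different gaps, which mean
-- nothing for the reals. With consecutive blocks these comparisons are forced by the positions. The
-- block length K has to exceed the number of base variables of any clause, since an assignment may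
-- put them all into one gap, and the number of base arguments of any predicate. The verdict is a
-- Boolean, and equations between Booleans are stable under double negation. This is why truth
-- values and representatives known only up to ¬¬ are good enough.

-- Ramsey's theorem for tuples of natural numbers and their order types.

module OrderRamsey where
  open import Data.List.Relation.Binary.Sublist.Propositional using (_⊆_; []; _∷_; _∷ʳ_; ⊆-refl; ⊆-trans; minimum)
  open import Data.List.Relation.Binary.Sublist.Propositional.Properties using (All-resp-⊆)
  open import Data.Nat using (_+_; _≤_; _<_; _≤?_)
  open import Data.Nat.Properties
    using ( <-isStrictTotalOrder; ≤-refl; ≤-reflexive; ≤-trans; <-trans; <-≤-trans; <-irrefl; <⇒≱; ≰⇒>; n≤1+n
          ; +-mono-≤; +-mono-<; +-mono-≤-<; +-suc; suc-injective)

  data Cmp : Set where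
    less equal greater : Cmp

  triCmp : ∀ {a b c} {A : Set a} {B : Set b} {C : Set c} → Tri A B C → Cmp
  triCmp (tri< _ _ _) = less
  triCmp (tri≈ _ _ _) = equal
  triCmp (tri> _ _ _) = greater

  module Comparing {A : Set} {_<_ : A → A → Set} (isSTO : IsStrictTotalOrder _≡_ _<_) where
    open IsStrictTotalOrder isSTO using (compare)

    cmp : A → A → Cmp
    cmp x y = triCmp (compare x y)

    less⇒< : ∀ {x y} → cmp x y ≡ less → x < y
    less⇒< {x} {y} e with compare x y
    ... | tri< x<y _ _ = x<y

    equal⇒≡ : ∀ {x y} → cmp x y ≡ equal → x ≡ y
    equal⇒≡ {x} {y} e with compare x y
    ... | tri≈ _ x≡y _ = x≡y

    greater⇒> : ∀ {x y} → cmp x y ≡ greater → y < x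
    greater⇒> {x} {y} e with compare x y
    ... | tri> _ _ y<x = y<x

    <⇒less : ∀ {x y} → x < y → cmp x y ≡ less
    <⇒less {x} {y} p with compare x y
    ... | tri< _ _ _ = refl
    ... | tri≈ ¬p _ _ = contradiction p ¬p
    ... | tri> ¬p _ _ = contradiction p ¬p

    ≡⇒equal : ∀ {x y} → x ≡ y → cmp x y ≡ equal
    ≡⇒equal {x} {y} p with compare x y
    ... | tri< _ ¬p _ = contradiction p ¬p
    ... | tri≈ _ _ _ = refl
    ... | tri> _ ¬p _ = contradiction p ¬p

    >⇒greater : ∀ {x y} → y < x → cmp x y ≡ greater
    >⇒greater {x} {y} p with compare x y
    ... | tri< _ _ ¬p = contradiction p ¬p
    ... | tri≈ _ _ ¬p = contradiction p ¬p
    ... | tri> _ _ _ = refl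

  module ℕᶜ = Comparing <-isStrictTotalOrder
  open ℕᶜ public using () renaming (cmp to cmpℕ)

  isLess : Cmp → ℕ
  isLess less    = 1
  isLess equal   = 0
  isLess greater = 0

  isLess≤1 : ∀ c → isLess c ≤ 1
  isLess≤1 less    = ≤-refl
  isLess≤1 equal   = z≤n
  isLess≤1 greater = z≤n

  module _ {X : Set} where

    -- Smaller entries are counted with multiplicity; only comparisons of ranks matter, and
    -- `cmp-rank` shows that these are right. The comparison is a parameter so that ranks computed
    -- from reals and from abstract elements can be identified by `rank-cong`.
    rank : (X → X → Cmp) → List X → X → ℕ
    rank c []       x = 0
    rank c (y ∷ ys) x = isLess (c y x) + rank c ys x

    rank≤length : ∀ c ys x → rank c ys x ≤ length ys
    rank≤length c []       x = z≤n
    rank≤length c (y ∷ ys) x = +-mono-≤ (isLess≤1 (c y x)) (rank≤length c ys x)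

    rank-cong : ∀ {c c′ : X → X → Cmp} ys {x} → (∀ {y} → y ∈ ys → c y x ≡ c′ y x) → rank c ys x ≡ rank c′ ys x
    rank-cong []       h = refl
    rank-cong (y ∷ ys) h = cong₂ (λ c n → isLess c + n) (h (here refl)) (rank-cong ys (h ∘ there))

  rank-map : ∀ {X Y : Set} {c : Y → Y → Cmp} (f : X → Y) ys x → rank c (map f ys) (f x) ≡ rank (λ a b → c (f a) (f b)) ys x
  rank-map f []       x = refl
  rank-map f (y ∷ ys) x = cong (_ +_) (rank-map f ys x)

  module RankComparing {A : Set} {_<ᴬ_ : A → A → Set} (isSTO : IsStrictTotalOrder _≡_ _<ᴬ_) {X : Set} (v : X → A) where
    open Comparing isSTO
    open IsStrictTotalOrder isSTO using () renaming (trans to <ᴬ-trans)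

    _≶_ : X → X → Cmp
    x ≶ y = cmp (v x) (v y)

    private
      isLess-mono : ∀ {x y} z → v x <ᴬ v y → isLess (z ≶ x) ≤ isLess (z ≶ y)
      isLess-mono {x} {y} z x<y with cmp (v z) (v x) in e
      ... | less    = ≤-reflexive (cong isLess (sym (<⇒less (<ᴬ-trans (less⇒< e) x<y))))
      ... | equal   = z≤n
      ... | greater = z≤n

    rank-mono-≤ : ∀ ys {x y} → v x <ᴬ v y → rank _≶_ ys x ≤ rank _≶_ ys y
    rank-mono-≤ []       x<y = z≤n
    rank-mono-≤ (z ∷ ys) x<y = +-mono-≤ (isLess-mono z x<y) (rank-mono-≤ ys x<y)

    -- Strictness comes from the occurrence of `x` itself in the list: it is counted for `y` but not
    -- for `x`.
    rank-mono-< : ∀ {ys x y} → x ∈ ys → v x <ᴬ v y → rank _≶_ ys x < rank _≶_ ys y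
    rank-mono-< {x ∷ ys} {y = y} (here refl) x<y
      rewrite ≡⇒equal {v x} refl | <⇒less x<y = s≤s (rank-mono-≤ ys x<y)
    rank-mono-< {z ∷ ys}         (there x∈)  x<y = +-mono-≤-< (isLess-mono z x<y) (rank-mono-< x∈ x<y)

    cmp-rank : ∀ {ys x y} → x ∈ ys → y ∈ ys → cmpℕ (rank _≶_ ys x) (rank _≶_ ys y) ≡ x ≶ y
    cmp-rank {ys} {x} {y} x∈ y∈ with cmp (v x) (v y) in e
    ... | less    = ℕᶜ.<⇒less (rank-mono-< x∈ (less⇒< e))
    ... | greater = ℕᶜ.>⇒greater (rank-mono-< y∈ (greater⇒> e))
    ... | equal   = ℕᶜ.≡⇒equal (same ys)
      where
      same : ∀ zs → rank _≶_ zs x ≡ rank _≶_ zs y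
      same []       = refl
      same (z ∷ zs) = cong₂ _+_ (cong (λ a → isLess (cmp (v z) a)) (equal⇒≡ e)) (same zs)

  module _ {a} {A : Set a} where

    listsOf : ℕ → List A → List (List A)
    listsOf zero    xs = [] ∷ []
    listsOf (suc n) xs = cartesianProductWith _∷_ xs (listsOf n xs)

    ∈-listsOf⁺ : ∀ {xs ys} → All (_∈ xs) ys → ys ∈ listsOf (length ys) xs
    ∈-listsOf⁺ []         = here refl
    ∈-listsOf⁺ (p ∷ ps) = ∈-cartesianProductWith⁺ _∷_ p (∈-listsOf⁺ ps)

    -- junk value: out-of-range indices return the default
    nth : A → List A → ℕ → A
    nth d []       _       = d
    nth d (x ∷ xs) zero    = x
    nth d (x ∷ xs) (suc n) = nth d xs n

    nth-∈ : ∀ d xs {n} → n < length xs → nth d xs n ∈ xs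
    nth-∈ d (x ∷ xs) {zero}  _       = here refl
    nth-∈ d (x ∷ xs) {suc n} (s≤s p) = there (nth-∈ d xs p)

    ∈-nth : ∀ d {xs x} → x ∈ xs → ∃ λ n → n < length xs × nth d xs n ≡ x
    ∈-nth d (here refl) = zero , s≤s z≤n , refl
    ∈-nth d (there p) with ∈-nth d p
    ... | n , n< , e = suc n , s≤s n< , e

  nth-map : ∀ {a b} {A : Set a} {B : Set b} (f : A → B) d e xs {n} → n < length xs →
            nth e (map f xs) n ≡ f (nth d xs n)
  nth-map f d e (x ∷ xs) {zero}  _       = refl
  nth-map f d e (x ∷ xs) {suc n} (s≤s p) = nth-map f d e xs p

  AllPairs-resp-⊆ : ∀ {a ℓ} {A : Set a} {R : A → A → Set ℓ} {xs ys : List A} →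
                    xs ⊆ ys → AllPairs R ys → AllPairs R xs
  AllPairs-resp-⊆ []         []       = []
  AllPairs-resp-⊆ (y ∷ʳ s)   (_ ∷ ps) = AllPairs-resp-⊆ s ps
  AllPairs-resp-⊆ (refl ∷ s) (p ∷ ps) = All-resp-⊆ s p ∷ AllPairs-resp-⊆ s ps

  nth-mono-< : ∀ d {xs} → AllPairs _<_ xs → ∀ {i j} → i < j → j < length xs → nth d xs i < nth d xs j
  nth-mono-< d {x ∷ xs} (p ∷ ps) {zero}  {suc j} _         (s≤s j<) = All.lookup p (nth-∈ d xs j<)
  nth-mono-< d {x ∷ xs} (p ∷ ps) {suc i} {suc j} (s≤s i<j) (s≤s j<) = nth-mono-< d ps i<j j<

  module _ {A : Set} where

    Homogeneous : (List A → Bool) → ℕ → Bool → List A → Set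
    Homogeneous f d c ys = ∀ {zs} → zs ⊆ ys → length zs ≡ d → f zs ≡ c

    -- The colour of a subsequence of length `suc d` depends on its first element alone, and each
    -- element is stored with that colour. This is the end-homogeneous sequence of the Erdős-Rado
    -- proof.
    data EndHomogeneous (f : List A → Bool) (d : ℕ) : List (A × Bool) → Set where
      []  : EndHomogeneous f d []
      _∷_ : ∀ {x c ps} → Homogeneous (f ∘ (x ∷_)) d c (map proj₁ ps) →
            EndHomogeneous f d ps → EndHomogeneous f d ((x , c) ∷ ps)

    pick : Bool → List (A × Bool) → List A
    pick b     []                 = []
    pick true  ((x , true)  ∷ ps) = x ∷ pick true ps
    pick false ((x , false) ∷ ps) = x ∷ pick false ps
    pick true  ((x , false) ∷ ps) = pick true ps
    pick false ((x , true)  ∷ ps) = pick false ps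

    pick-⊆ : ∀ b ps → pick b ps ⊆ map proj₁ ps
    pick-⊆ b     []                 = []
    pick-⊆ true  ((x , true)  ∷ ps) = refl ∷ pick-⊆ true ps
    pick-⊆ false ((x , false) ∷ ps) = refl ∷ pick-⊆ false ps
    pick-⊆ true  ((x , false) ∷ ps) = x ∷ʳ pick-⊆ true ps
    pick-⊆ false ((x , true)  ∷ ps) = x ∷ʳ pick-⊆ false ps

    pick-length : ∀ ps → length (pick true ps) + length (pick false ps) ≡ length ps
    pick-length []                 = refl
    pick-length ((x , true)  ∷ ps) = cong suc (pick-length ps)
    pick-length ((x , false) ∷ ps) = trans (+-suc _ _) (cong suc (pick-length ps))

    pick-homogeneous : ∀ {f d} b {ps} → EndHomogeneous f d ps → Homogeneous f (suc d) b (pick b ps)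
    pick-homogeneous b     []                       []         ()
    pick-homogeneous true  (_∷_ {c = true}  h hs)  (_ ∷ʳ s)   e = pick-homogeneous true hs s e
    pick-homogeneous true  (_∷_ {c = true} {ps = ps}  h hs)  (refl ∷ s) e = h (⊆-trans s (pick-⊆ true ps)) (suc-injective e)
    pick-homogeneous true  (_∷_ {c = false} h hs)  s          e = pick-homogeneous true hs s e
    pick-homogeneous false (_∷_ {c = false} h hs)  (_ ∷ʳ s)   e = pick-homogeneous false hs s e
    pick-homogeneous false (_∷_ {c = false} {ps = ps} h hs)  (refl ∷ s) e = h (⊆-trans s (pick-⊆ false ps)) (suc-injective e)
    pick-homogeneous false (_∷_ {c = true}  h hs)  s          e = pick-homogeneous false hs s e

    +-split : ∀ m {p q} → m + m ≤ p + q → m ≤ p ⊎ m ≤ q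
    +-split m {p} {q} M≤ with m ≤? p | m ≤? q
    ... | yes m≤p | _       = inj₁ m≤p
    ... | no  _   | yes m≤q = inj₂ m≤q
    ... | no  m≰p | no  m≰q = contradiction M≤ (<⇒≱ (+-mono-< (≰⇒> m≰p) (≰⇒> m≰q)))

    -- `M` is chosen before the colouring and the list. `endBound` relies on this: it uses the bound
    -- for the colouring `f ∘ (x ∷_)`, which is known only once the head `x` is.
    RamseyBound : ℕ → ℕ → Set
    RamseyBound d m = Σ ℕ λ M → ∀ (f : List A → Bool) xs → M ≤ length xs →
      Σ (List A) λ ys → ys ⊆ xs × m ≤ length ys × ∃ λ c → Homogeneous f d c ys

    EndBound : ℕ → ℕ → Set
    EndBound d m = Σ ℕ λ M → ∀ (f : List A → Bool) xs → M ≤ length xs →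
      Σ (List (A × Bool)) λ ps → map proj₁ ps ⊆ xs × m ≤ length ps × EndHomogeneous f d ps

    -- Keep the head `x`, thin out the tail until the colour of whatever follows `x` is constant,
    -- and continue inside the thinned tail.
    endBound : ∀ d → (∀ m → RamseyBound d m) → ∀ m → EndBound d m
    endBound d ram zero    = 0 , λ f xs _ → [] , minimum xs , z≤n , []
    endBound d ram (suc m) with endBound d ram m
    ... | M , end with ram M
    ...   | M′ , ram′ = suc M′ , go
      where
      go : ∀ f xs → suc M′ ≤ length xs →
           Σ (List (A × Bool)) λ ps → map proj₁ ps ⊆ xs × suc m ≤ length ps × EndHomogeneous f d ps
      go f (x ∷ xs) (s≤s M≤) with ram′ (f ∘ (x ∷_)) xs M≤
      ... | ys , ys⊆xs , M≤ , c , hom with end f ys M≤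
      ...   | ps , ps⊆ys , m≤ , eh =
        (x , c) ∷ ps , refl ∷ ⊆-trans ps⊆ys ys⊆xs , s≤s m≤ , (λ s → hom (⊆-trans s ps⊆ys)) ∷ eh

    -- Induction on the size of the coloured sets: in an end-homogeneous list of length at least
    -- `m + m`, one of the two stored colours occurs at least `m` times.
    ramsey : ∀ d m → RamseyBound d m
    ramsey zero    m = m , λ f xs M≤ → xs , ⊆-refl , M≤ , f [] , λ { {[]} _ _ → refl }
    ramsey (suc d) m with endBound d (ramsey d) (m + m)
    ... | M , end = M , go
      where
      go : ∀ f xs → M ≤ length xs →
           Σ (List A) λ ys → ys ⊆ xs × m ≤ length ys × ∃ λ c → Homogeneous f (suc d) c ys
      go f xs M≤ with end f xs M≤
      ... | ps , ps⊆xs , m+m≤ , eh with +-split m (subst (m + m ≤_) (sym (pick-length ps)) m+m≤)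
      ...   | inj₁ m≤ = pick true ps , ⊆-trans (pick-⊆ true ps) ps⊆xs , m≤ , true , pick-homogeneous true eh
      ...   | inj₂ m≤ = pick false ps , ⊆-trans (pick-⊆ false ps) ps⊆xs , m≤ , false , pick-homogeneous false eh

    -- Homogeneity passes to sublists, so the colourings can be treated one after another, each
    -- inside the list obtained from the one before.
    ramseyAll : ∀ (fs : List (ℕ × (List A → Bool))) m → Σ ℕ λ M → ∀ xs → M ≤ length xs →
      Σ (List A) λ ys → ys ⊆ xs × m ≤ length ys ×
        All (λ df → ∃ λ c → Homogeneous (proj₂ df) (proj₁ df) c ys) fs
    ramseyAll []             m = m , λ xs M≤ → xs , ⊆-refl , M≤ , []
    ramseyAll ((d , f) ∷ fs) m with ramseyAll fs m
    ... | M , ram with ramsey d M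
    ...   | M′ , ram′ = M′ , go
      where
      go : ∀ xs → M′ ≤ length xs → Σ (List A) λ ys → ys ⊆ xs × m ≤ length ys ×
           All (λ df → ∃ λ c → Homogeneous (proj₂ df) (proj₁ df) c ys) ((d , f) ∷ fs)
      go xs M≤ with ram′ f xs M≤
      ... | ys , ys⊆xs , M≤ , c , hom with ram ys M≤
      ...   | zs , zs⊆ys , m≤ , homs = zs , ⊆-trans zs⊆ys ys⊆xs , m≤ , (c , λ s → hom (⊆-trans s zs⊆ys)) ∷ homs

  -- Two tuples of the same length are given as the list of pairs of their entries.
  OrderEquivalent : List (ℕ × ℕ) → Set
  OrderEquivalent ps = ∀ {u v} → u ∈ ps → v ∈ ps → cmpℕ (proj₁ u) (proj₁ v) ≡ cmpℕ (proj₂ u) (proj₂ v)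

  _<²_ : ℕ × ℕ → ℕ × ℕ → Set
  u <² v = proj₁ u < proj₁ v × proj₂ u < proj₂ v

  <²-trans : ∀ {u v w} → u <² v → v <² w → u <² w
  <²-trans (p , q) (p′ , q′) = <-trans p p′ , <-trans q q′

  -- A single list that enumerates the entries of both tuples increasingly at once. Equal pairs are
  -- merged, so a tuple with repetitions yields a shorter list; this is where sizes `d` below the
  -- length of the tuple come from.
  record Sorting (ps : List (ℕ × ℕ)) : Set where
    field
      sorted   : List (ℕ × ℕ)
      ordered  : AllPairs _<²_ sorted
      covers   : ∀ {u} → u ∈ ps → u ∈ sorted
      covered  : ∀ {u} → u ∈ sorted → u ∈ ps
      shorter  : length sorted ≤ length ps

  insert : ∀ u qs → AllPairs _<²_ qs → (∀ {v} → v ∈ qs → cmpℕ (proj₁ u) (proj₁ v) ≡ cmpℕ (proj₂ u) (proj₂ v)) →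
    Σ (List (ℕ × ℕ)) λ rs → AllPairs _<²_ rs × (∀ {v} → v ∈ u ∷ qs → v ∈ rs) ×
      (∀ {v} → v ∈ rs → v ∈ u ∷ qs) × length rs ≤ suc (length qs)
  insert u [] _ _ = u ∷ [] , [] ∷ [] , id , id , ≤-refl
  insert u (q ∷ qs) (p ∷ ps) oe with cmpℕ (proj₁ u) (proj₁ q) in e | oe (here refl)
  ... | less | e₂ = u ∷ q ∷ qs , (u<q ∷ All.map (<²-trans u<q) p) ∷ p ∷ ps , id , id , ≤-refl
    where
    u<q : u <² q
    u<q = ℕᶜ.less⇒< e , ℕᶜ.less⇒< (sym e₂)
  ... | equal | e₂ = q ∷ qs , p ∷ ps , (λ { (here refl) → here u≡q ; (there v∈) → v∈ }) , there , n≤1+n _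
    where
    u≡q : u ≡ q
    u≡q = cong₂ _,_ (ℕᶜ.equal⇒≡ e) (ℕᶜ.equal⇒≡ (sym e₂))
  ... | greater | e₂ with insert u qs ps (oe ∘ there)
  ...   | rs , ord , cov , cov⁻ , sh =
    q ∷ rs , All.tabulate (λ v∈ → q<v (cov⁻ v∈)) ∷ ord
      , (λ { (here refl) → there (cov (here refl)) ; (there (here refl)) → here refl ; (there (there v∈)) → there (cov (there v∈)) })
      , (λ { (here refl) → there (here refl) ; (there v∈) → swap (cov⁻ v∈) })
      , s≤s sh
    where
    q<v : ∀ {v} → v ∈ u ∷ qs → q <² v
    q<v (here refl) = ℕᶜ.greater⇒> e , ℕᶜ.greater⇒> (sym e₂)
    q<v (there v∈)  = All.lookup p v∈
    swap : ∀ {v} → v ∈ u ∷ qs → v ∈ u ∷ q ∷ qs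
    swap (here refl) = here refl
    swap (there v∈)  = there (there v∈)

  sorting : ∀ ps → OrderEquivalent ps → Sorting ps
  sorting [] _ = record { sorted = [] ; ordered = [] ; covers = id ; covered = id ; shorter = z≤n }
  sorting (u ∷ ps) oe with sorting ps (λ a b → oe (there a) (there b))
  ... | s with insert u sorted ordered (λ v∈ → oe (here refl) (there (covered v∈)))
    where open Sorting s
  ... | rs , ord , cov , cov⁻ , sh = record
    { sorted  = rs
    ; ordered = ord
    ; covers  = λ { (here refl) → cov (here refl) ; (there v∈) → cov (there (covers v∈)) }
    ; covered = λ v∈ → back (cov⁻ v∈)
    ; shorter = ≤-trans sh (s≤s shorter)
    }
    where
    open Sorting s
    back : ∀ {v} → v ∈ u ∷ sorted → v ∈ u ∷ ps
    back (here refl) = here refl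
    back (there v∈)  = there (covered v∈)

  -- Homogeneity speaks of sublists, whereas selected indices are only known to be members of the
  -- homogeneous list. For increasing lists membership is enough.
  increasing-⊆ : ∀ {xs ys} → AllPairs _<_ xs → AllPairs _<_ ys → All (_∈ ys) xs → xs ⊆ ys
  increasing-⊆ {ys = ys} [] _ _ = minimum ys
  increasing-⊆ (_∷_ {x} p ps) (_∷_ {y} q qs) (here refl ∷ xs∈) =
    refl ∷ increasing-⊆ ps qs (All.tabulate λ {z} z∈ → tail (All.lookup p z∈) (All.lookup xs∈ z∈))
    where
    tail : ∀ {z ys} → x < z → z ∈ x ∷ ys → z ∈ ys
    tail x<z (here refl) = contradiction x<z (<-irrefl refl)
    tail x<z (there z∈)  = z∈
  increasing-⊆ (_∷_ {x} p ps) (_∷_ {y} q qs) (there x∈ ∷ xs∈) =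
    y ∷ʳ increasing-⊆ (p ∷ ps) qs (x∈ ∷ All.tabulate λ {z} z∈ → tail (All.lookup p z∈) (All.lookup xs∈ z∈))
    where
    tail : ∀ {z} → x < z → z ∈ y ∷ _ → z ∈ _
    tail x<z (here refl) = contradiction (<-trans x<z (All.lookup q x∈)) (<-irrefl refl)
    tail x<z (there z∈)  = z∈

  -- A k-tuple is a set of d ≤ k numbers together with a pattern τ of indices into its increasing enumeration.
  tupleColourings : List (ℕ × (List ℕ → Bool)) → List (ℕ × (List ℕ → Bool))
  tupleColourings = concatMap λ { (k , Q) →
    cartesianProductWith (λ d τ → d , λ is → Q (map (nth 0 is) τ)) (upTo (suc k)) (listsOf k (upTo k)) }

  ∈-tupleColourings : ∀ {Qs k Q d τ} → (k , Q) ∈ Qs → d < suc k → length τ ≡ k → All (_< k) τ →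
    (d , λ is → Q (map (nth 0 is) τ)) ∈ tupleColourings Qs
  ∈-tupleColourings {Qs} {Q = Q} kQ∈ d< refl τ< = ∈-concatMap⁺ _ (Any.map (λ { refl →
    ∈-cartesianProductWith⁺ (λ d τ → d , λ is → Q (map (nth 0 is) τ)) (∈-upTo⁺ d<) (∈-listsOf⁺ (All.map ∈-upTo⁺ τ<)) }) kQ∈)

  -- Order-equivalent tuples share the size `d` and the pattern `τ`. They are decoded by the same
  -- `τ` from two sublists of length `d` of the homogeneous list, and these have the same colour.
  -- `h` enumerates that list.
  tupleRamsey : ∀ (Qs : List (ℕ × (List ℕ → Bool))) m → Σ (ℕ → ℕ) λ h →
    (∀ {i j} → i < j → j < m → h i < h j) ×
    (∀ {k Q} → (k , Q) ∈ Qs → ∀ ps → length ps ≡ k → All (λ u → proj₁ u < m × proj₂ u < m) ps →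
       OrderEquivalent ps → Q (map (h ∘ proj₁) ps) ≡ Q (map (h ∘ proj₂) ps))
  tupleRamsey Qs m with ramseyAll (tupleColourings Qs) m
  ... | M , ram with ram (upTo M) (≤-reflexive (sym (Listₚ.length-upTo M)))
  ...   | ys , ys⊆ , m≤ , homs = h , h-mono , invariant
    where
    h : ℕ → ℕ
    h = nth 0 ys

    ys-incr : AllPairs _<_ ys
    ys-incr = AllPairs-resp-⊆ ys⊆ (AllPairsₚ.applyUpTo⁺₁ id M (λ i<j _ → i<j))

    h-mono : ∀ {i j} → i < j → j < m → h i < h j
    h-mono i<j j<m = nth-mono-< 0 ys-incr i<j (<-≤-trans j<m m≤)

    selection-⊆ : ∀ (π : ℕ × ℕ → ℕ) {qs} → (∀ {u v} → u <² v → π u < π v) → All (λ u → π u < m) qs →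
             AllPairs _<²_ qs → map (h ∘ π) qs ⊆ ys
    selection-⊆ π {qs} mono <m ap = increasing-⊆ (incr <m ap) ys-incr (Allₚ.map⁺ (All.map (λ u<m → nth-∈ 0 ys (<-≤-trans u<m m≤)) <m))
      where
      incr : ∀ {qs} → All (λ u → π u < m) qs → AllPairs _<²_ qs → AllPairs _<_ (map (h ∘ π) qs)
      incr []        []       = []
      incr (_ ∷ <m) (p ∷ ps) = Allₚ.map⁺ (All.zipWith (λ { (u<v , v<m) → h-mono (mono u<v) v<m }) (p , <m)) ∷ incr <m ps

    invariant : ∀ {k Q} → (k , Q) ∈ Qs → ∀ ps → length ps ≡ k → All (λ u → proj₁ u < m × proj₂ u < m) ps →
       OrderEquivalent ps → Q (map (h ∘ proj₁) ps) ≡ Q (map (h ∘ proj₂) ps)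
    invariant {k} {Q} kQ∈ ps refl <m oe = begin
      Q (map (h ∘ proj₁) ps)
        ≡⟨ cong Q (sym (reindex proj₁ ps self)) ⟩
      Q (map (nth 0 (map (h ∘ proj₁) sorted)) (τ ps self))
        ≡⟨ hom (selection-⊆ proj₁ proj₁ (All.map proj₁ sorted<m) ordered) (Listₚ.length-map _ sorted) ⟩
      c
        ≡⟨ sym (hom (selection-⊆ proj₂ proj₂ (All.map proj₂ sorted<m) ordered) (Listₚ.length-map _ sorted)) ⟩
      Q (map (nth 0 (map (h ∘ proj₂) sorted)) (τ ps self))
        ≡⟨ cong Q (reindex proj₂ ps self) ⟩
      Q (map (h ∘ proj₂) ps) ∎
      where
      open ≡-Reasoning
      self : All (_∈ ps) ps
      self = All.tabulate id
      open Sorting (sorting ps oe)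
      sorted<m : All (λ u → proj₁ u < m × proj₂ u < m) sorted
      sorted<m = All.tabulate (λ u∈ → All.lookup <m (covered u∈))
      index : ∀ {u} → u ∈ ps → ∃ λ n → n < length sorted × nth (0 , 0) sorted n ≡ u
      index u∈ = ∈-nth (0 , 0) (covers u∈)
      τ : ∀ qs → All (_∈ ps) qs → List ℕ
      τ []       []         = []
      τ (q ∷ qs) (q∈ ∷ qs∈) = proj₁ (index q∈) ∷ τ qs qs∈
      τ-length : ∀ qs qs∈ → length (τ qs qs∈) ≡ length qs
      τ-length []       []         = refl
      τ-length (q ∷ qs) (q∈ ∷ qs∈) = cong suc (τ-length qs qs∈)
      τ< : ∀ qs qs∈ → All (_< k) (τ qs qs∈)
      τ< []       []         = []
      τ< (q ∷ qs) (q∈ ∷ qs∈) = <-≤-trans (proj₁ (proj₂ (index q∈))) shorter ∷ τ< qs qs∈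
      reindex : ∀ (π : ℕ × ℕ → ℕ) qs qs∈ → map (nth 0 (map (h ∘ π) sorted)) (τ qs qs∈) ≡ map (h ∘ π) qs
      reindex π []       []         = refl
      reindex π (q ∷ qs) (q∈ ∷ qs∈) with index q∈
      ... | n , n< , refl = cong₂ _∷_ (nth-map (h ∘ π) (0 , 0) 0 sorted n<) (reindex π qs qs∈)
      colour = All.lookup homs (∈-tupleColourings kQ∈ (s≤s shorter) (τ-length ps self) (τ< ps self))
      c = proj₁ colour
      hom = proj₂ colour

open OrderRamsey

-- Enumerating functions on a finite domain.

module FiniteFunctions {A B : Set} (_≟_ : DecidableEquality A) (default : B) where

  update : A → B → (A → B) → A → B
  update a b f x = if does (x ≟ a) then b else f x

  functions : List A → List B → List (A → B)
  functions []       bs = (λ _ → default) ∷ []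
  functions (a ∷ as) bs = cartesianProductWith (update a) bs (functions as bs)

  -- Agreement holds on the listed arguments only; elsewhere an enumerated function takes the
  -- default value. For assignments this suffices, because a clause reads them only at its own
  -- variables.
  functions-complete : ∀ as {bs} (g : A → B) → (∀ {a} → a ∈ as → g a ∈ bs) →
                       ∃ λ f → f ∈ functions as bs × (∀ {a} → a ∈ as → f a ≡ g a)
  functions-complete []       g g∈ = _ , here refl , λ ()
  functions-complete (a ∷ as) g g∈ with functions-complete as g (λ p → g∈ (there p))
  ... | f , f∈ , f≡g = update a (g a) f , ∈-cartesianProductWith⁺ (update a) (g∈ (here refl)) f∈ , agrees
    where
    agrees : ∀ {x} → x ∈ a ∷ as → update a (g a) f x ≡ g x
    agrees {x} x∈ with x ≟ a
    agrees x∈         | yes refl = refl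
    agrees (here p)   | no x≢a   = contradiction p x≢a
    agrees (there x∈) | no x≢a   = f≡g x∈

  functions-range : ∀ as {bs f a} → f ∈ functions as bs → a ∈ as → f a ∈ bs
  functions-range (a ∷ as) {bs} {a = x} f∈ x∈ with ∈-cartesianProductWith⁻ (update a) bs (functions as bs) f∈
  ... | b , f′ , b∈ , f′∈ , refl with x ≟ a
  functions-range (a ∷ as) f∈ x∈         | b , f′ , b∈ , f′∈ , refl | yes _   = b∈
  functions-range (a ∷ as) f∈ (here p)   | b , f′ , b∈ , f′∈ , refl | no x≢a = contradiction p x≢a
  functions-range (a ∷ as) f∈ (there x∈) | b , f′ , b∈ , f′∈ , refl | no x≢a = functions-range as f′∈ x∈

-- Clearing denominators in ℚ.

natℚ : ℕ → ℚ
natℚ zero    = 0ℚ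
natℚ (suc n) = 1ℚ ℚ.+ natℚ n

toℚᵘ-natℚ : ∀ n → toℚᵘ (natℚ n) ℚᵘ.≃ mkℚᵘ (ℤ.+ n) 0
toℚᵘ-natℚ zero    = *≡* refl
toℚᵘ-natℚ (suc n) = ℚᵘₚ.≃-trans (ℚₚ.toℚᵘ-homo-+ 1ℚ (natℚ n))
  (ℚᵘₚ.≃-trans (ℚᵘₚ.+-congʳ (toℚᵘ 1ℚ) (toℚᵘ-natℚ n)) (*≡* (cong (λ k → (ℤ.+ 1 ℤ.+ k) ℤ.* ℤ.+ 1) (ℤₚ.*-identityʳ (ℤ.+ n)))))

denominator-* : ∀ n d .(c : Coprime n (suc d)) → mkℚ (ℤ.+ n) d c ℚ.* natℚ (suc d) ≡ natℚ n
denominator-* n d c = ℚₚ.toℚᵘ-injective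
  (ℚᵘₚ.≃-trans (ℚₚ.toℚᵘ-homo-* (mkℚ (ℤ.+ n) d c) (natℚ (suc d)))
  (ℚᵘₚ.≃-trans (ℚᵘₚ.*-congˡ {mkℚᵘ (ℤ.+ n) d} (toℚᵘ-natℚ (suc d)))
  (ℚᵘₚ.≃-trans (*≡* (trans (ℤₚ.*-identityʳ _) (cong (λ k → ℤ.+ n ℤ.* ℤ.+ suc k) (sym (ℕₚ.*-identityʳ d)))))
               (ℚᵘₚ.≃-sym (toℚᵘ-natℚ n)))))

-- Ordered field arithmetic and the embedding of ℚ.

module OrderedField (R : RealField) where
  open RealField R

  commutativeRing : CommutativeRing 0ℓ 0ℓ
  commutativeRing = record { isCommutativeRing = isCommutativeRing }

  open CommutativeRing commutativeRing public
    using (+-identityˡ; +-identityʳ; -‿inverseʳ; *-identityʳ; zeroʳ)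
  open IsStrictTotalOrder isStrictTotalOrder public
    using (compare) renaming (trans to <-trans; irrefl to <-irrefl)

  private module G = Algebra.Properties.Group (CommutativeRing.+-group commutativeRing)

  ι-0 : ι 0ℚ ≡ 0r
  ι-0 = G.identityˡ-unique (ι 0ℚ) (ι 0ℚ) (sym (ι-+ 0ℚ 0ℚ))

  ι-neg : ∀ p → ι (ℚ.- p) ≡ - ι p
  ι-neg p = G.inverseʳ-unique (ι p) (ι (ℚ.- p))
    (trans (sym (ι-+ p (ℚ.- p))) (trans (cong ι (ℚₚ.+-inverseʳ p)) ι-0))

  -- ι is a ring homomorphism, so ℚ can serve as the (decidable) coefficient ring.
  private
    ι-morphism : CommutativeRing.rawRing ℚₚ.+-*-commutativeRing -Raw-AlmostCommutative⟶ fromCommutativeRing commutativeRing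
    ι-morphism = record
      { ⟦_⟧ = ι ; +-homo = ι-+ ; *-homo = ι-* ; -‿homo = ι-neg ; 0-homo = ι-0 ; 1-homo = ι-1 }

  open Algebra.Solver.Ring (CommutativeRing.rawRing ℚₚ.+-*-commutativeRing) (fromCommutativeRing commutativeRing)
    ι-morphism (λ p q → Maybe.map (cong ι) (dec⇒maybe (p ℚ.≟ q))) public
    using (solve; _:=_; _:+_; _:*_; _:-_; :-_; con)

  <⇒≢ : ∀ {x y} → x < y → ¬ x ≡ y
  <⇒≢ x<y x≡y = <-irrefl x≡y x<y

  <⇒0<- : ∀ {x y} → x < y → 0r < y - x
  <⇒0<- {x} x<y = subst (_< _) (-‿inverseʳ x) (+-mono-< (- x) x<y)

  0<-⇒< : ∀ {x y} → 0r < y - x → x < y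
  0<-⇒< {x} {y} p = subst₂ _<_ (+-identityˡ x) (solve 2 (λ x y → y :- x :+ x := y) refl x y) (+-mono-< x p)

  0≡-⇒≡ : ∀ {x y} → 0r ≡ y - x → x ≡ y
  0≡-⇒≡ {x} {y} p = sym (G.x∙y⁻¹≈ε⇒x≈y y x (sym p))

  ≤⇒0≤- : ∀ {x y} → x ≤ y → 0r ≤ y - x
  ≤⇒0≤- (inj₁ x<y)  = inj₁ (<⇒0<- x<y)
  ≤⇒0≤- {x} (inj₂ refl) = inj₂ (sym (-‿inverseʳ x))

  0≤-⇒≤ : ∀ {x y} → 0r ≤ y - x → x ≤ y
  0≤-⇒≤ (inj₁ p) = inj₁ (0<-⇒< p)
  0≤-⇒≤ (inj₂ p) = inj₂ (0≡-⇒≡ p)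

  <-≤-trans : ∀ {x y z} → x < y → y ≤ z → x < z
  <-≤-trans p (inj₁ q)    = <-trans p q
  <-≤-trans p (inj₂ refl) = p

  ≤-<-trans : ∀ {x y z} → x ≤ y → y < z → x < z
  ≤-<-trans (inj₁ p)    q = <-trans p q
  ≤-<-trans (inj₂ refl) q = q

  ≤-trans : ∀ {x y z} → x ≤ y → y ≤ z → x ≤ z
  ≤-trans (inj₁ p)    q = inj₁ (<-≤-trans p q)
  ≤-trans (inj₂ refl) q = q

  ≤-total : ∀ x y → x ≤ y ⊎ y ≤ x
  ≤-total x y with compare x y
  ... | tri< p _ _ = inj₁ (inj₁ p)
  ... | tri≈ _ p _ = inj₁ (inj₂ p)
  ... | tri> _ _ p = inj₂ (inj₁ p)

  neg-pos : ∀ {x} → x < 0r → 0r < - x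
  neg-pos {x} p = subst (0r <_) (+-identityˡ (- x)) (<⇒0<- p)

  0<1 : 0r < 1r
  0<1 with compare 0r 1r
  ... | tri< p _ _ = p
  ... | tri≈ _ p _ = contradiction p 0≢1
  ... | tri> _ _ p = subst (0r <_) (trans (solve 1 (λ x → (:- x) :* (:- x) := x :* x) refl 1r) (*-identityʳ 1r)) (*-pos (neg-pos p) (neg-pos p))

  +-pos : ∀ {x y} → 0r < x → 0r < y → 0r < x + y
  +-pos {x} {y} p q = <-trans q (subst (_< x + y) (+-identityˡ y) (+-mono-< y p))

  *-cancel-pos : ∀ {a x} → 0r < a → 0r < a * x → 0r < x
  *-cancel-pos {a} {x} 0<a 0<ax with compare 0r x
  ... | tri< p _ _    = p
  ... | tri≈ _ refl _ = contradiction 0<ax (<-irrefl (sym (zeroʳ a)))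
  ... | tri> _ _ p    = contradiction
    (subst (0r <_) (solve 2 (λ a x → a :* x :+ a :* (:- x) := con 0ℚ) refl a x) (+-pos 0<ax (*-pos 0<a (neg-pos p))))
    (<-irrefl (sym ι-0))

  0≡-0 : 0r ≡ - 0r
  0≡-0 = sym G.ε⁻¹≈ε

  *-cancel-zero : ∀ {a x} → 0r < a → 0r ≡ a * x → 0r ≡ x
  *-cancel-zero {a} {x} 0<a e with compare 0r x
  ... | tri< p _ _ = contradiction e (<⇒≢ (*-pos 0<a p))
  ... | tri≈ _ p _ = p
  ... | tri> _ _ p = contradiction
    (trans 0≡-0 (trans (cong -_ e) (solve 2 (λ a x → :- (a :* x) := a :* (:- x)) refl a x)))
    (<⇒≢ (*-pos 0<a (neg-pos p)))

  Pos : Bool → Carrier → Set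
  Pos true  x = 0r < x
  Pos false x = 0r ≤ x

  *-Pos : ∀ s {a x} → 0r < a → Pos s x → Pos s (a * x)
  *-Pos true  0<a p             = *-pos 0<a p
  *-Pos false 0<a (inj₁ p)      = inj₁ (*-pos 0<a p)
  *-Pos false {a} 0<a (inj₂ refl) = inj₂ (sym (zeroʳ a))

  *-cancel-Pos : ∀ s {a x} → 0r < a → Pos s (a * x) → Pos s x
  *-cancel-Pos true  0<a p        = *-cancel-pos 0<a p
  *-cancel-Pos false 0<a (inj₁ p) = inj₁ (*-cancel-pos 0<a p)
  *-cancel-Pos false 0<a (inj₂ p) = inj₂ (*-cancel-zero 0<a p)

  +-Pos : ∀ s t {x y} → Pos s x → Pos t y → Pos (s ∨ t) (x + y)
  +-Pos true  true  p             q             = +-pos p q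
  +-Pos true  false p             (inj₁ q)      = +-pos p q
  +-Pos true  false {x} p         (inj₂ refl)   = subst (0r <_) (sym (+-identityʳ x)) p
  +-Pos false true  (inj₁ p)      q             = +-pos p q
  +-Pos false true  {y = y} (inj₂ refl) q       = subst (0r <_) (sym (+-identityˡ y)) q
  +-Pos false false (inj₁ p)      (inj₁ q)      = inj₁ (+-pos p q)
  +-Pos false false {x} (inj₁ p)  (inj₂ refl)   = inj₁ (subst (0r <_) (sym (+-identityʳ x)) p)
  +-Pos false false {y = y} (inj₂ refl) q       = subst (0r ≤_) (sym (+-identityˡ y)) q

  ι-nat-pos : ∀ n → 0r < ι (natℚ (suc n))
  ι-nat-pos zero    = subst (0r <_) (sym ι-1) 0<1
  ι-nat-pos (suc n) = subst (0r <_) (sym (ι-+ 1ℚ (natℚ (suc n)))) (+-pos (ι-nat-pos zero) (ι-nat-pos n))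

  -- The axioms for `ι` say nothing about order. Multiplying by the denominator reduces the claim to
  -- `natℚ`, whose positive members are mapped to sums of copies of `1r`.
  ι-pos : ∀ {p} → 0ℚ ℚ.< p → 0r < ι p
  ι-pos {mkℚ (ℤ.+ suc n) d c} _ = *-cancel-pos (ι-nat-pos d)
    (subst (0r <_) (trans (cong ι (trans (sym (denominator-* (suc n) d c)) (ℚₚ.*-comm (mkℚ (ℤ.+ suc n) d c) (natℚ (suc d)))))
                          (ι-* _ _))
      (ι-nat-pos n))
  ι-pos {mkℚ (ℤ.+ zero) d c}  (ℚ.*<* (ℤ.+<+ ()))
  ι-pos {mkℚ -[1+ n ] d c}  (ℚ.*<* ())

  ι-neg-pos : ∀ {p} → p ℚ.< 0ℚ → 0r < - ι p
  ι-neg-pos {p} p<0 = subst (0r <_) (ι-neg p) (ι-pos (ℚₚ.neg-antimono-< p<0))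

  mid : Carrier → Carrier → Carrier
  mid x y = ι ½ * (x + y)

  <-mid : ∀ {x y} → x < y → x < mid x y
  <-mid {x} {y} p = 0<-⇒< (subst (0r <_)
    (solve 2 (λ x y → con ½ :* (y :- x) := con ½ :* (x :+ y) :- x) refl x y)
    (*-pos (ι-pos (ℚₚ.positive⁻¹ ½)) (<⇒0<- p)))

  mid-< : ∀ {x y} → x < y → mid x y < y
  mid-< {x} {y} p = 0<-⇒< (subst (0r <_)
    (solve 2 (λ x y → con ½ :* (y :- x) := y :- con ½ :* (x :+ y)) refl x y)
    (*-pos (ι-pos (ℚₚ.positive⁻¹ ½)) (<⇒0<- p)))

  x<x+1 : ∀ x → x < x + 1r
  x<x+1 x = 0<-⇒< (subst (0r <_) (solve 2 (λ x o → o := x :+ o :- x) refl x 1r) 0<1)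

  x-1<x : ∀ x → x - 1r < x
  x-1<x x = 0<-⇒< (subst (0r <_) (solve 2 (λ x o → o := x :- (x :- o)) refl x 1r) 0<1)

-- Fourier-Motzkin elimination.

-- An affine form: the coefficients of the variables in order, then the constant term. The outermost
-- coefficient belongs to the variable eliminated next.
Form : ℕ → Set
Form zero    = ℚ
Form (suc n) = ℚ × Form n

constForm : ∀ n → ℚ → Form n
constForm zero    q = q
constForm (suc n) q = 0ℚ , constForm n q

-- junk value: a variable outside the range is read as 0
varForm : ∀ n → ℕ → Form n
varForm zero    k       = 0ℚ
varForm (suc n) zero    = 1ℚ , constForm n 0ℚ
varForm (suc n) (suc k) = 0ℚ , varForm n k

addForm : ∀ n → Form n → Form n → Form n
addForm zero    p       q       = p ℚ.+ q
addForm (suc n) (a , f) (b , g) = a ℚ.+ b , addForm n f g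

scaleForm : ∀ n → ℚ → Form n → Form n
scaleForm zero    c p       = c ℚ.* p
scaleForm (suc n) c (a , f) = c ℚ.* a , scaleForm n c f

subForm : ∀ n → Form n → Form n → Form n
subForm n f g = addForm n f (scaleForm n (ℚ.- 1ℚ) g)

-- (true , f) stands for 0 < f and (false , f) for 0 ≤ f.
LinCon : ℕ → Set
LinCon n = Bool × Form n

data Bound (n : ℕ) : Set where
  lower upper rest : Bool → Form n → Bound n

-- With `x` the variable to be eliminated, `a x + f` equals `a (x - g)` for `g = - f / a`. So `g`
-- bounds `x` from below if `a` is positive and from above if `a` is negative.
toBound : ∀ {n} → LinCon (suc n) → Bound n
toBound {n} (s , a , f) with ℚₚ.<-cmp 0ℚ a
... | tri< 0<a _ _ = lower s (scaleForm n (ℚ.- (ℚ.1/_ a {{ℚ.>-nonZero 0<a}})) f)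
... | tri≈ _ _ _   = rest s f
... | tri> _ _ a<0 = upper s (scaleForm n (ℚ.- (ℚ.1/_ a {{ℚ.<-nonZero a<0}})) f)

lowers uppers rests : ∀ {n} → List (Bound n) → List (LinCon n)
lowers []               = []
lowers (lower s f ∷ bs) = (s , f) ∷ lowers bs
lowers (upper _ _ ∷ bs) = lowers bs
lowers (rest _ _ ∷ bs)  = lowers bs
uppers []               = []
uppers (lower _ _ ∷ bs) = uppers bs
uppers (upper s f ∷ bs) = (s , f) ∷ uppers bs
uppers (rest _ _ ∷ bs)  = uppers bs
rests []                = []
rests (lower _ _ ∷ bs)  = rests bs
rests (upper _ _ ∷ bs)  = rests bs
rests (rest s f ∷ bs)   = (s , f) ∷ rests bs

-- A value fits between a lower bound `l` and an upper bound `u` exactly when `l ≤ u`, or `l < u` as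
-- soon as one of the two is strict; hence the disjunction of the flags.
combine : ∀ {n} → LinCon n → LinCon n → LinCon n
combine {n} (s , l) (t , u) = s ∨ t , subForm n u l

eliminate : ∀ {n} → List (Bound n) → List (LinCon n)
eliminate bs = rests bs ++ cartesianProductWith combine (lowers bs) (uppers bs)

positiveᵇ : Bool × ℚ → Bool
positiveᵇ (true  , q) = does (0ℚ ℚ.<? q)
positiveᵇ (false , q) = does (0ℚ ℚ.≤? q)

fourierMotzkin : ∀ n → List (LinCon n) → Bool
fourierMotzkin zero    cs = all positiveᵇ cs
fourierMotzkin (suc n) cs = fourierMotzkin n (eliminate (map toBound cs))

termBound : GTerm → ℕ
termBound (num _)  = 0
termBound (skol k) = suc k
termBound (s ⊕ t)  = termBound s ⊔ termBound t
termBound (s ⊖ t)  = termBound s ⊔ termBound t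

toForm : ∀ n → GTerm → Form n
toForm n (num q)  = constForm n q
toForm n (skol k) = varForm n k
toForm n (s ⊕ t)  = addForm n (toForm n s) (toForm n t)
toForm n (s ⊖ t)  = subForm n (toForm n s) (toForm n t)

-- (true , s , t) stands for s < t and (false , s , t) for s ≤ t.
Comparison : Set
Comparison = Bool × GTerm × GTerm

variables : List Comparison → ℕ
variables []                 = 0
variables ((_ , s , t) ∷ cs) = (termBound s ⊔ termBound t) ⊔ variables cs

toLinCon : ∀ n → Comparison → LinCon n
toLinCon n (b , s , t) = b , subForm n (toForm n t) (toForm n s)

-- Every Skolem constant in `cs` has an index below `variables cs`, so `varForm` never returns its
-- junk value here.
feasible : List Comparison → Bool
feasible cs = fourierMotzkin (variables cs) (map (toLinCon (variables cs)) cs)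

all-true⇒All : ∀ {A : Set} {p : A → Bool} xs → all p xs ≡ true → All (λ x → p x ≡ true) xs
all-true⇒All []       _ = []
all-true⇒All {p = p} (x ∷ xs) e with p x in px
... | true = px ∷ all-true⇒All xs e

All⇒all-true : ∀ {A : Set} {p : A → Bool} {xs} → All (λ x → p x ≡ true) xs → all p xs ≡ true
All⇒all-true []         = refl
All⇒all-true (px ∷ pxs) rewrite px = All⇒all-true pxs

does-true : ∀ {P : Set} (P? : Dec P) → does P? ≡ true → P
does-true (yes p) _ = p

module FourierMotzkin (R : RealField) where
  open RealField R
  open OrderedField R

  evalForm : ∀ n → Form n → (ℕ → Carrier) → Carrier
  evalForm zero    q       v = ι q
  evalForm (suc n) (a , f) v = ι a * v 0 + evalForm n f (v ∘ suc)

  evalForm-const : ∀ n q v → evalForm n (constForm n q) v ≡ ι q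
  evalForm-const zero    q v = refl
  evalForm-const (suc n) q v = trans (cong (λ e → ι 0ℚ * v 0 + e) (evalForm-const n q (v ∘ suc)))
    (solve 2 (λ x y → con 0ℚ :* x :+ y := y) refl (v 0) (ι q))

  evalForm-var : ∀ n {k} v → k ℕ.< n → evalForm n (varForm n k) v ≡ v k
  evalForm-var (suc n) {zero}  v _           = trans (cong (λ e → ι 1ℚ * v 0 + e) (evalForm-const n 0ℚ (v ∘ suc)))
    (solve 1 (λ x → con 1ℚ :* x :+ con 0ℚ := x) refl (v 0))
  evalForm-var (suc n) {suc k} v (ℕ.s≤s k<n) = trans (cong (λ e → ι 0ℚ * v 0 + e) (evalForm-var n (v ∘ suc) k<n))
    (solve 2 (λ x y → con 0ℚ :* x :+ y := y) refl (v 0) (v (suc k)))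

  evalForm-add : ∀ n f g v → evalForm n (addForm n f g) v ≡ evalForm n f v + evalForm n g v
  evalForm-add zero    p       q       v = ι-+ p q
  evalForm-add (suc n) (a , f) (b , g) v = trans (cong₂ (λ c e → c * v 0 + e) (ι-+ a b) (evalForm-add n f g (v ∘ suc)))
    (solve 5 (λ a b x f g → (a :+ b) :* x :+ (f :+ g) := (a :* x :+ f) :+ (b :* x :+ g)) refl
       (ι a) (ι b) (v 0) (evalForm n f (v ∘ suc)) (evalForm n g (v ∘ suc)))

  evalForm-scale : ∀ n c f v → evalForm n (scaleForm n c f) v ≡ ι c * evalForm n f v
  evalForm-scale zero    c p       v = ι-* c p
  evalForm-scale (suc n) c (a , f) v = trans (cong₂ (λ b e → b * v 0 + e) (ι-* c a) (evalForm-scale n c f (v ∘ suc)))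
    (solve 4 (λ c a x f → (c :* a) :* x :+ c :* f := c :* (a :* x :+ f)) refl (ι c) (ι a) (v 0) (evalForm n f (v ∘ suc)))

  evalForm-sub : ∀ n f g v → evalForm n (subForm n f g) v ≡ evalForm n f v - evalForm n g v
  evalForm-sub n f g v = trans (evalForm-add n f _ v) (trans (cong (λ e → evalForm n f v + e) (evalForm-scale n (ℚ.- 1ℚ) g v))
    (solve 2 (λ x y → x :+ con (ℚ.- 1ℚ) :* y := x :- y) refl (evalForm n f v) (evalForm n g v)))

  Holds : ∀ {n} → (ℕ → Carrier) → LinCon n → Set
  Holds {n} v (s , f) = Pos s (evalForm n f v)

  HoldsBound : ∀ {n} → Carrier → (ℕ → Carrier) → Bound n → Set
  HoldsBound {n} x v (lower s f) = Pos s (x - evalForm n f v)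
  HoldsBound {n} x v (upper s f) = Pos s (evalForm n f v - x)
  HoldsBound {n} x v (rest s f)  = Pos s (evalForm n f v)

  private
    isolate : ∀ n a .{{_ : ℚ.NonZero a}} f x v →
      ι a * x + evalForm n f v ≡ ι a * (x - evalForm n (scaleForm n (ℚ.- (ℚ.1/ a)) f) v)
    isolate n a f x v = sym (trans (cong (λ e → ι a * (x - e)) (evalForm-scale n (ℚ.- (ℚ.1/ a)) f v))
      (trans (solve 4 (λ a c x f → a :* (x :- c :* f) := a :* x :- (a :* c) :* f) refl (ι a) (ι (ℚ.- (ℚ.1/ a))) x (evalForm n f v))
      (trans (cong (λ e → ι a * x - e * evalForm n f v) a*c≡-1)
        (solve 2 (λ y f → y :- con (ℚ.- 1ℚ) :* f := y :+ f) refl (ι a * x) (evalForm n f v)))))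
      where
      a*c≡-1 : ι a * ι (ℚ.- (ℚ.1/ a)) ≡ ι (ℚ.- 1ℚ)
      a*c≡-1 = trans (sym (ι-* a _)) (cong ι (trans (sym (ℚₚ.neg-distribʳ-* a (ℚ.1/ a))) (cong ℚ.-_ (ℚₚ.*-inverseʳ a))))

    flip-sign : ∀ a x g → a * (x - g) ≡ (- a) * (g - x)
    flip-sign = solve 3 (λ a x g → a :* (x :- g) := (:- a) :* (g :- x)) refl

  toBound-sound : ∀ {n} (c : LinCon (suc n)) v → HoldsBound (v 0) (v ∘ suc) (toBound c) → Holds v c
  toBound-sound {n} (s , a , f) v h with ℚₚ.<-cmp 0ℚ a
  ... | tri< 0<a _ _  = subst (Pos s) (sym (isolate n a {{ℚ.>-nonZero 0<a}} f (v 0) (v ∘ suc))) (*-Pos s (ι-pos 0<a) h)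
  ... | tri≈ _ refl _ = subst (Pos s) (solve 2 (λ x f → f := con 0ℚ :* x :+ f) refl (v 0) (evalForm n f (v ∘ suc))) h
  ... | tri> _ _ a<0  = subst (Pos s) (sym (trans (isolate n a {{ℚ.<-nonZero a<0}} f (v 0) (v ∘ suc)) (flip-sign _ _ _)))
                          (*-Pos s (ι-neg-pos a<0) h)

  toBound-complete : ∀ {n} (c : LinCon (suc n)) v → Holds v c → HoldsBound (v 0) (v ∘ suc) (toBound c)
  toBound-complete {n} (s , a , f) v h with ℚₚ.<-cmp 0ℚ a
  ... | tri< 0<a _ _  = *-cancel-Pos s (ι-pos 0<a) (subst (Pos s) (isolate n a {{ℚ.>-nonZero 0<a}} f (v 0) (v ∘ suc)) h)
  ... | tri≈ _ refl _ = subst (Pos s) (solve 2 (λ x f → con 0ℚ :* x :+ f := f) refl (v 0) (evalForm n f (v ∘ suc))) h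
  ... | tri> _ _ a<0  = *-cancel-Pos s (ι-neg-pos a<0)
                          (subst (Pos s) (trans (isolate n a {{ℚ.<-nonZero a<0}} f (v 0) (v ∘ suc)) (flip-sign _ _ _)) h)

  HoldsLower HoldsUpper : ∀ {n} → Carrier → (ℕ → Carrier) → LinCon n → Set
  HoldsLower {n} x v (s , f) = Pos s (x - evalForm n f v)
  HoldsUpper {n} x v (s , f) = Pos s (evalForm n f v - x)

  unsplit : ∀ {n} (bs : List (Bound n)) {x v} → All (HoldsLower x v) (lowers bs) → All (HoldsUpper x v) (uppers bs) →
            All (Holds v) (rests bs) → All (HoldsBound x v) bs
  unsplit []               ls       us       rs       = []
  unsplit (lower s f ∷ bs) (l ∷ ls) us       rs       = l ∷ unsplit bs ls us rs
  unsplit (upper s f ∷ bs) ls       (u ∷ us) rs       = u ∷ unsplit bs ls us rs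
  unsplit (rest s f ∷ bs)  ls       us       (r ∷ rs) = r ∷ unsplit bs ls us rs

  split : ∀ {n} (bs : List (Bound n)) {x v} → All (HoldsBound x v) bs →
          All (HoldsLower x v) (lowers bs) × All (HoldsUpper x v) (uppers bs) × All (Holds v) (rests bs)
  split []               []       = [] , [] , []
  split (lower s f ∷ bs) (h ∷ hs) = let ls , us , rs = split bs hs in h ∷ ls , us , rs
  split (upper s f ∷ bs) (h ∷ hs) = let ls , us , rs = split bs hs in ls , h ∷ us , rs
  split (rest s f ∷ bs)  (h ∷ hs) = let ls , us , rs = split bs hs in ls , us , h ∷ rs

  maximum : ∀ {A : Set} (f : A → Carrier) x xs → ∃ λ m → m ∈ x ∷ xs × All (λ y → f y ≤ f m) (x ∷ xs)
  maximum f x []       = x , here refl , inj₂ refl ∷ []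
  maximum f x (y ∷ xs) with maximum f y xs
  ... | m , m∈ , ≤m with ≤-total (f x) (f m)
  ...   | inj₁ x≤m = m , there m∈ , x≤m ∷ ≤m
  ...   | inj₂ m≤x = x , here refl , inj₂ refl ∷ All.map (λ y≤m → ≤-trans y≤m m≤x) ≤m

  minimum : ∀ {A : Set} (f : A → Carrier) x xs → ∃ λ m → m ∈ x ∷ xs × All (λ y → f m ≤ f y) (x ∷ xs)
  minimum f x []       = x , here refl , inj₂ refl ∷ []
  minimum f x (y ∷ xs) with minimum f y xs
  ... | m , m∈ , m≤ with ≤-total (f m) (f x)
  ...   | inj₁ m≤x = m , there m∈ , m≤x ∷ m≤
  ...   | inj₂ x≤m = x , here refl , inj₂ refl ∷ All.map (λ m≤y → ≤-trans x≤m m≤y) m≤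

  <⇒Pos : ∀ s {x y} → x < y → Pos s (y - x)
  <⇒Pos true  x<y = <⇒0<- x<y
  <⇒Pos false x<y = inj₁ (<⇒0<- x<y)

  Pos⇒≤ : ∀ s {x y} → Pos s (y - x) → x ≤ y
  Pos⇒≤ true  p = inj₁ (0<-⇒< p)
  Pos⇒≤ false p = 0≤-⇒≤ p

  weakenˡ : ∀ s t {x} → Pos (s ∨ t) x → Pos s x
  weakenˡ true  t     p = p
  weakenˡ false true  p = inj₁ p
  weakenˡ false false p = p

  weakenʳ : ∀ s t {x} → Pos (s ∨ t) x → Pos t x
  weakenʳ true  true  p = p
  weakenʳ true  false p = inj₁ p
  weakenʳ false t     p = p

  -- Only the greatest lower bound and the least upper bound matter: take their midpoint, or go one
  -- unit beyond the extreme bound if the other side is empty.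
  interpolate : ∀ {n} v (ls us : List (LinCon n)) →
    (∀ {l u} → l ∈ ls → u ∈ us → Pos (proj₁ l ∨ proj₁ u) (evalForm n (proj₂ u) v - evalForm n (proj₂ l) v)) →
    ∃ λ x → All (HoldsLower x v) ls × All (HoldsUpper x v) us
  interpolate {n} v [] [] h = 0r , [] , []
  interpolate {n} v (l ∷ ls) [] h with maximum (λ c → evalForm n (proj₂ c) v) l ls
  ... | m , m∈ , ≤m = _ , All.map (λ {c} c≤m → <⇒Pos (proj₁ c) (≤-<-trans c≤m (x<x+1 _))) ≤m , []
  interpolate {n} v [] (u ∷ us) h with minimum (λ c → evalForm n (proj₂ c) v) u us
  ... | m , m∈ , m≤ = _ , [] , All.map (λ {c} m≤c → <⇒Pos (proj₁ c) (<-≤-trans (x-1<x _) m≤c)) m≤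
  interpolate {n} v (l ∷ ls) (u ∷ us) h
    with maximum (λ c → evalForm n (proj₂ c) v) l ls | minimum (λ c → evalForm n (proj₂ c) v) u us
  ... | m , m∈ , ≤m | k , k∈ , k≤ with Pos⇒≤ (proj₁ m ∨ proj₁ k) (h m∈ k∈)
  ...   | inj₁ m<k = _ , All.map (λ {c} c≤m → <⇒Pos (proj₁ c) (≤-<-trans c≤m (<-mid m<k))) ≤m
                       , All.map (λ {c} k≤c → <⇒Pos (proj₁ c) (<-≤-trans (mid-< m<k) k≤c)) k≤
  -- The extreme bounds coincide and leave a single value. Each lower bound is compared with `k` and
  -- each upper bound with `m`, because `h` then carries the strictness of that very bound.
  ...   | inj₂ m≡k = evalForm n (proj₂ m) v
      , All.tabulate (λ {c} c∈ → weakenˡ (proj₁ c) (proj₁ k) (subst (λ e → Pos (proj₁ c ∨ proj₁ k) (e - evalForm n (proj₂ c) v)) (sym m≡k) (h c∈ k∈)))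
      , All.tabulate (λ {c} c∈ → weakenʳ (proj₁ m) (proj₁ c) (h m∈ c∈))

  _◂_ : Carrier → (ℕ → Carrier) → ℕ → Carrier
  (x ◂ v) zero    = x
  (x ◂ v) (suc n) = v n

  eliminate-sound : ∀ {n} (bs : List (Bound n)) v → All (Holds v) (eliminate bs) → ∃ λ x → All (HoldsBound x v) bs
  eliminate-sound {n} bs v h with interpolate v (lowers bs) (uppers bs) (λ {l} {u} l∈ u∈ →
      subst (Pos (proj₁ l ∨ proj₁ u)) (evalForm-sub n (proj₂ u) (proj₂ l) v)
        (All.lookup h (∈-++⁺ʳ (rests bs) (∈-cartesianProductWith⁺ combine l∈ u∈))))
  ... | x , ls , us = x , unsplit bs ls us (Allₚ.++⁻ˡ (rests bs) h)

  eliminate-complete : ∀ {n} (bs : List (Bound n)) x v → All (HoldsBound x v) bs → All (Holds v) (eliminate bs)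
  eliminate-complete {n} bs x v h with split bs h
  ... | ls , us , rs = Allₚ.++⁺ rs (All.tabulate pair)
    where
    pair : ∀ {c} → c ∈ cartesianProductWith combine (lowers bs) (uppers bs) → Holds v c
    pair c∈ with ∈-cartesianProductWith⁻ combine (lowers bs) (uppers bs) c∈
    ... | (s , l) , (t , u) , l∈ , u∈ , refl = subst (Pos (s ∨ t))
      (trans (solve 3 (λ x l u → (x :- l) :+ (u :- x) := u :- l) refl x (evalForm n l v) (evalForm n u v)) (sym (evalForm-sub n u l v)))
      (+-Pos s t (All.lookup ls l∈) (All.lookup us u∈))

  ι-nonneg : ∀ {p} → 0ℚ ℚ.≤ p → 0r ≤ ι p
  ι-nonneg {p} 0≤p with ℚₚ.<-cmp 0ℚ p
  ... | tri< 0<p _ _  = inj₁ (ι-pos 0<p)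
  ... | tri≈ _ refl _ = inj₂ (sym ι-0)
  ... | tri> _ _ p<0  = contradiction (ℚₚ.<-≤-trans p<0 0≤p) (ℚₚ.<-irrefl refl)

  positiveᵇ-sound : ∀ c → positiveᵇ c ≡ true → Pos (proj₁ c) (ι (proj₂ c))
  positiveᵇ-sound (true  , q) e = ι-pos (does-true (0ℚ ℚ.<? q) e)
  positiveᵇ-sound (false , q) e = ι-nonneg (does-true (0ℚ ℚ.≤? q) e)

  pos-not-neg : ∀ {x} → 0r < x → ¬ 0r < - x
  pos-not-neg {x} p q = <-irrefl (sym (-‿inverseʳ x)) (+-pos p q)

  ι-cancel-pos : ∀ {p} → 0r < ι p → 0ℚ ℚ.< p
  ι-cancel-pos {p} h with ℚₚ.<-cmp 0ℚ p
  ... | tri< 0<p _ _  = 0<p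
  ... | tri≈ _ refl _ = contradiction h (<-irrefl (sym ι-0))
  ... | tri> _ _ p<0  = contradiction (ι-neg-pos p<0) (pos-not-neg h)

  ι-cancel-nonneg : ∀ {p} → 0r ≤ ι p → 0ℚ ℚ.≤ p
  ι-cancel-nonneg {p} h with ℚₚ.<-cmp 0ℚ p
  ... | tri< 0<p _ _  = ℚₚ.<⇒≤ 0<p
  ... | tri≈ _ refl _ = ℚₚ.≤-refl
  ... | tri> _ _ p<0  with h
  ...   | inj₁ 0<ιp = contradiction (ι-neg-pos p<0) (pos-not-neg 0<ιp)
  ...   | inj₂ 0≡ιp = contradiction (ι-neg-pos p<0)
    (<-irrefl (trans 0≡-0 (cong -_ 0≡ιp)))

  positiveᵇ-complete : ∀ c → Pos (proj₁ c) (ι (proj₂ c)) → positiveᵇ c ≡ true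
  positiveᵇ-complete (true  , q) h = dec-true (0ℚ ℚ.<? q) (ι-cancel-pos h)
  positiveᵇ-complete (false , q) h = dec-true (0ℚ ℚ.≤? q) (ι-cancel-nonneg h)

  fourierMotzkin-sound : ∀ n cs → fourierMotzkin n cs ≡ true → ∃ λ v → All (Holds {n} v) cs
  fourierMotzkin-sound zero    cs e = (λ _ → 0r) , All.map (λ {c} → positiveᵇ-sound c) (all-true⇒All cs e)
  fourierMotzkin-sound (suc n) cs e with fourierMotzkin-sound n (eliminate (map toBound cs)) e
  ... | v , h with eliminate-sound (map toBound cs) v h
  ...   | x , hs = x ◂ v , All.map (λ {c} → toBound-sound c (x ◂ v)) (Allₚ.map⁻ hs)

  fourierMotzkin-complete : ∀ n cs v → All (Holds {n} v) cs → fourierMotzkin n cs ≡ true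
  fourierMotzkin-complete zero    cs v h = All⇒all-true (All.map (λ {c} → positiveᵇ-complete c) h)
  fourierMotzkin-complete (suc n) cs v h = fourierMotzkin-complete n (eliminate (map toBound cs)) (v ∘ suc)
    (eliminate-complete (map toBound cs) (v 0) (v ∘ suc) (Allₚ.map⁺ (All.map (λ {c} → toBound-complete c v) h)))

  evalTerm : (ℕ → Carrier) → GTerm → Carrier
  evalTerm v (num q)  = ι q
  evalTerm v (skol k) = v k
  evalTerm v (s ⊕ t)  = evalTerm v s + evalTerm v t
  evalTerm v (s ⊖ t)  = evalTerm v s - evalTerm v t

  evalForm-term : ∀ n t v → termBound t ℕ.≤ n → evalForm n (toForm n t) v ≡ evalTerm v t
  evalForm-term n (num q)  v _  = evalForm-const n q v
  evalForm-term n (skol k) v b≤n = evalForm-var n v b≤n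
  evalForm-term n (s ⊕ t)  v b≤n = trans (evalForm-add n (toForm n s) (toForm n t) v)
    (cong₂ _+_ (evalForm-term n s v (ℕₚ.m⊔n≤o⇒m≤o (termBound s) _ b≤n)) (evalForm-term n t v (ℕₚ.m⊔n≤o⇒n≤o (termBound s) _ b≤n)))
  evalForm-term n (s ⊖ t)  v b≤n = trans (evalForm-sub n (toForm n s) (toForm n t) v)
    (cong₂ _-_ (evalForm-term n s v (ℕₚ.m⊔n≤o⇒m≤o (termBound s) _ b≤n)) (evalForm-term n t v (ℕₚ.m⊔n≤o⇒n≤o (termBound s) _ b≤n)))

  HoldsComparison : (ℕ → Carrier) → Comparison → Set
  HoldsComparison v (true  , s , t) = evalTerm v s < evalTerm v t
  HoldsComparison v (false , s , t) = evalTerm v s ≤ evalTerm v t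

  private
    TermsBelow : ℕ → Comparison → Set
    TermsBelow n (_ , s , t) = termBound s ℕ.≤ n × termBound t ℕ.≤ n

    variables-bound : ∀ cs {n} → variables cs ℕ.≤ n → All (TermsBelow n) cs
    variables-bound []                 b≤n = []
    variables-bound ((_ , s , t) ∷ cs) b≤n =
      (ℕₚ.m⊔n≤o⇒m≤o (termBound s) _ b≤n′ , ℕₚ.m⊔n≤o⇒n≤o (termBound s) _ b≤n′)
      ∷ variables-bound cs (ℕₚ.m⊔n≤o⇒n≤o (termBound s ⊔ termBound t) _ b≤n)
      where b≤n′ = ℕₚ.m⊔n≤o⇒m≤o (termBound s ⊔ termBound t) _ b≤n

    difference : ∀ n s t v → termBound s ℕ.≤ n × termBound t ℕ.≤ n →
      evalForm n (subForm n (toForm n t) (toForm n s)) v ≡ evalTerm v t - evalTerm v s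
    difference n s t v (bs , bt) = trans (evalForm-sub n (toForm n t) (toForm n s) v)
      (cong₂ _-_ (evalForm-term n t v bt) (evalForm-term n s v bs))

    comparison-sound : ∀ {n} v c → TermsBelow n c → Holds v (toLinCon n c) → HoldsComparison v c
    comparison-sound {n} v (true  , s , t) b h = 0<-⇒< (subst (Pos true) (difference n s t v b) h)
    comparison-sound {n} v (false , s , t) b h = 0≤-⇒≤ (subst (Pos false) (difference n s t v b) h)

    comparison-complete : ∀ {n} v c → TermsBelow n c → HoldsComparison v c → Holds v (toLinCon n c)
    comparison-complete {n} v (true  , s , t) b h = subst (Pos true) (sym (difference n s t v b)) (<⇒0<- h)
    comparison-complete {n} v (false , s , t) b h = subst (Pos false) (sym (difference n s t v b)) (≤⇒0≤- h)

  feasible-sound : ∀ cs → feasible cs ≡ true → ∃ λ v → All (HoldsComparison v) cs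
  feasible-sound cs e with fourierMotzkin-sound (variables cs) (map (toLinCon (variables cs)) cs) e
  ... | v , h = v , All.zipWith (λ {c} (b , hc) → comparison-sound v c b hc) (variables-bound cs ℕₚ.≤-refl , Allₚ.map⁻ h)

  feasible-complete : ∀ cs v → All (HoldsComparison v) cs → feasible cs ≡ true
  feasible-complete cs v h = fourierMotzkin-complete (variables cs) (map (toLinCon (variables cs)) cs) v
    (Allₚ.map⁺ (All.zipWith (λ {c} (b , hc) → comparison-complete v c b hc) (variables-bound cs ℕₚ.≤-refl , h)))

-- Abstract base elements and their codes.

double : ℕ → ℕ
double zero    = zero
double (suc n) = suc (suc (double n))

even : ℕ → Bool
even zero          = true
even (suc zero)    = false
even (suc (suc n)) = even n

even-1+double : ∀ n → even (suc (double n)) ≡ false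
even-1+double zero    = refl
even-1+double (suc n) = even-1+double n

double-mono-< : ∀ {m n} → m ℕ.< n → suc (double m) ℕ.≤ double n
double-mono-< {zero}  (s≤s _) = s≤s z≤n
double-mono-< {suc m} (s≤s p) = s≤s (s≤s (double-mono-< p))

-- An element of the abstract base domain is a position relative to the thresholds (even: an open gap, odd: a
-- threshold) together with an index that orders the elements of a gap and is irrelevant at a threshold.
Elt : Set
Elt = ℕ × ℕ

-- Position `p` owns the block of `K` codes starting at `p * K`, so for indices below `K` codes
-- compare by position first and by index second. A threshold is one point, so its index is dropped.
-- In `val` the code also selects the member of the homogeneous set, which realises the consecutive
-- blocks.
flat : ℕ → Elt → ℕ
flat K (p , i) = p ℕ.* K ℕ.+ (if even p then i else 0)

module _ {K : ℕ} where

  offset< : ∀ p {i} → i ℕ.< K → (if even p then i else 0) ℕ.< K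
  offset< p i<K with even p
  ... | true  = i<K
  ... | false = ℕₚ.≤-<-trans z≤n i<K

  flat-bound : ∀ {p n i} → p ℕ.≤ n → i ℕ.< K → flat K (p , i) ℕ.< suc n ℕ.* K
  flat-bound {p} {n} {i} p≤n i<K = begin-strict
    p ℕ.* K ℕ.+ (if even p then i else 0) <⟨ ℕₚ.+-monoʳ-< (p ℕ.* K) (offset< p i<K) ⟩
    p ℕ.* K ℕ.+ K                         ≡⟨ ℕₚ.+-comm (p ℕ.* K) K ⟩
    suc p ℕ.* K                           ≤⟨ ℕₚ.*-monoˡ-≤ K (s≤s p≤n) ⟩
    suc n ℕ.* K                           ∎
    where open ℕₚ.≤-Reasoning

  flat-mono-< : ∀ {p q i} j → p ℕ.< q → i ℕ.< K → flat K (p , i) ℕ.< flat K (q , j)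
  flat-mono-< {p} {q} j (s≤s p≤q) i<K = ℕₚ.<-≤-trans (flat-bound p≤q i<K) (ℕₚ.m≤m+n (q ℕ.* K) _)

  flat-even : ∀ p i j → even p ≡ true → cmpℕ (flat K (p , i)) (flat K (p , j)) ≡ cmpℕ i j
  flat-even p i j e rewrite e with cmpℕ i j in c
  ... | less    = ℕᶜ.<⇒less (ℕₚ.+-monoʳ-< (p ℕ.* K) (ℕᶜ.less⇒< c))
  ... | equal   = ℕᶜ.≡⇒equal (cong (p ℕ.* K ℕ.+_) (ℕᶜ.equal⇒≡ c))
  ... | greater = ℕᶜ.>⇒greater (ℕₚ.+-monoʳ-< (p ℕ.* K) (ℕᶜ.greater⇒> c))

  flat-odd : ∀ p i j → even p ≡ false → flat K (p , i) ≡ flat K (p , j)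
  flat-odd p i j e rewrite e = refl

-- Positions of reals among the thresholds, and sample points.

module RealPositions (R : RealField) where
  open RealField R
  open OrderedField R
  open Comparing isStrictTotalOrder public

  -- The supremum of {0} ∪ {1 | Q} is below 1 exactly if Q fails.
  ¬-dec : (Q : Set) → Dec (¬ Q)
  ¬-dec Q with complete (λ x → x ≡ 0r ⊎ (x ≡ 1r × Q)) (0r , inj₁ refl)
                 (1r , λ { x (inj₁ refl) → inj₁ 0<1 ; x (inj₂ (refl , _)) → inj₂ refl })
  ... | s , ub , least = byComparison (compare s 1r)
    where
    s≤0 : ¬ Q → s ≤ 0r
    s≤0 ¬q = least 0r λ { x (inj₁ x≡0) → inj₂ x≡0 ; x (inj₂ (_ , q)) → contradiction q ¬q }
    byComparison : Tri (s < 1r) (s ≡ 1r) (1r < s) → Dec (¬ Q)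
    byComparison (tri< s<1 _ _) = yes λ q → <-irrefl refl (<-≤-trans s<1 (ub 1r (inj₂ (refl , q))))
    byComparison (tri≈ _ s≡1 _) = no λ ¬q → <-irrefl refl (<-≤-trans 0<1 (≤-trans (inj₂ (sym s≡1)) (s≤0 ¬q)))
    byComparison (tri> _ _ 1<s) = no λ ¬q → <-irrefl refl (<-≤-trans (<-trans 0<1 1<s) (s≤0 ¬q))

  step : Cmp → ℕ → ℕ
  step less    n = 0
  step equal   n = 1
  step greater n = suc (suc n)

  -- For increasing `ws`, each threshold below `x` contributes 2 and a threshold equal to `x`
  -- contributes 1.
  position : List Carrier → Carrier → ℕ
  position []       x = 0
  position (w ∷ ws) x = step (cmp x w) (position ws x)

  position-mono : ∀ ws {x y} → x < y → position ws x ℕ.≤ position ws y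
  position-mono []       x<y = z≤n
  position-mono (w ∷ ws) {x} {y} x<y with cmp x w in e
  ... | less    = z≤n
  ... | equal   rewrite >⇒greater (subst (_< y) (equal⇒≡ e) x<y) = s≤s z≤n
  ... | greater rewrite >⇒greater (<-trans (greater⇒> e) x<y) = s≤s (s≤s (position-mono ws x<y))

  position-odd-injective : ∀ ws {x y} → position ws x ≡ position ws y → even (position ws x) ≡ false → x ≡ y
  position-odd-injective (w ∷ ws) {x} {y} p odd with cmp x w in ex | cmp y w in ey
  ... | equal   | equal   = trans (equal⇒≡ ex) (sym (equal⇒≡ ey))
  ... | greater | greater = position-odd-injective ws (ℕₚ.suc-injective (ℕₚ.suc-injective p)) odd

  position-bound : ∀ ws x → position ws x ℕ.≤ double (length ws)
  position-bound []       x = z≤n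
  position-bound (w ∷ ws) x with cmp x w
  ... | less    = z≤n
  ... | equal   = s≤s z≤n
  ... | greater = s≤s (s≤s (position-bound ws x))

  position-nth : ∀ d {ws j} → AllPairs _<_ ws → j ℕ.< length ws → position ws (nth d ws j) ≡ suc (double j)
  position-nth d {w ∷ ws} {zero}  (_ ∷ _) _         rewrite ≡⇒equal {w} refl = refl
  position-nth d {w ∷ ws} {suc j} (p ∷ ps) (s≤s j<) rewrite >⇒greater (All.lookup p (nth-∈ d ws j<)) =
    cong (suc ∘ suc) (position-nth d ps j<)

  -- Different positions already decide the order of the reals by `position-mono`, and equal odd
  -- positions mean the same threshold. The indices therefore have to be right only for two reals in
  -- a common gap.
  cmp-flat : ∀ ws {K x y i j} → i ℕ.< K → j ℕ.< K →
    (position ws x ≡ position ws y → even (position ws x) ≡ true → cmpℕ i j ≡ cmp x y) →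
    cmpℕ (flat K (position ws x , i)) (flat K (position ws y , j)) ≡ cmp x y
  cmp-flat ws {K} {x} {y} {i} {j} i<K j<K h with ℕₚ.<-cmp (position ws x) (position ws y)
  ... | tri< px<py _ _ = trans (ℕᶜ.<⇒less (flat-mono-< j px<py i<K)) (sym (<⇒less x<y))
    where
    x<y : x < y
    x<y with compare x y
    ... | tri< p _ _    = p
    ... | tri≈ _ refl _ = contradiction px<py (ℕₚ.<-irrefl refl)
    ... | tri> _ _ p    = contradiction (position-mono ws p) (ℕₚ.<⇒≱ px<py)
  ... | tri> _ _ py<px = trans (ℕᶜ.>⇒greater (flat-mono-< i py<px j<K)) (sym (>⇒greater y<x))
    where
    y<x : y < x
    y<x with compare y x
    ... | tri< p _ _    = p
    ... | tri≈ _ refl _ = contradiction py<px (ℕₚ.<-irrefl refl)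
    ... | tri> _ _ p    = contradiction (position-mono ws p) (ℕₚ.<⇒≱ py<px)
  ... | tri≈ _ px≡py _ = byParity (even (position ws x)) refl
    where
    byParity : ∀ b → even (position ws x) ≡ b → cmpℕ (flat K (position ws x , i)) (flat K (position ws y , j)) ≡ cmp x y
    byParity true  e = trans (cong (λ p → cmpℕ (flat K (position ws x , i)) (flat K (p , j))) (sym px≡py))
                         (trans (flat-even (position ws x) i j e) (h px≡py e))
    byParity false e = trans (ℕᶜ.≡⇒equal (trans (flat-odd (position ws x) i j e) (cong (λ p → flat K (p , j)) px≡py)))
                         (sym (≡⇒equal (position-odd-injective ws px≡py e)))

  -- Bisecting towards `b` keeps all points inside the interval and each one above its predecessor.
  gap : Carrier → Carrier → ℕ → Carrier
  gap a b zero    = mid a b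
  gap a b (suc i) = mid (gap a b i) b

  gap-< : ∀ {a b} → a < b → ∀ i → gap a b i < b
  gap-< a<b zero    = mid-< a<b
  gap-< a<b (suc i) = mid-< (gap-< a<b i)

  gap-step : ∀ {a b} → a < b → ∀ i → gap a b i < gap a b (suc i)
  gap-step a<b i = <-mid (gap-< a<b i)

  gap-> : ∀ {a b} → a < b → ∀ i → a < gap a b i
  gap-> a<b zero    = <-mid a<b
  gap-> a<b (suc i) = <-trans (gap-> a<b i) (gap-step a<b i)

  gap-mono : ∀ {a b} → a < b → ∀ {i j} → i ℕ.< j → gap a b i < gap a b j
  gap-mono a<b {i} {suc j} (s≤s i≤j) with ℕₚ.m≤n⇒m<n∨m≡n i≤j
  ... | inj₁ i<j  = <-trans (gap-mono a<b i<j) (gap-step a<b j)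
  ... | inj₂ refl = gap-step a<b i

  -- Here a is a real below all of ws; the gap at position 0 is cut down to (a , w).
  sample : Carrier → List Carrier → ℕ → ℕ → Carrier
  -- The gap above the last threshold is unbounded; `a + 1r` is an arbitrary right end. Positions
  -- beyond that gap are junk and land here too.
  sample a []       p             i = gap a (a + 1r) i
  sample a (w ∷ ws) zero          i = gap a w i
  sample a (w ∷ ws) (suc zero)    i = w
  sample a (w ∷ ws) (suc (suc p)) i = sample w ws p i

  sample-> : ∀ {a ws} → AllPairs _<_ (a ∷ ws) → ∀ p i → a < sample a ws p i
  sample-> {a} {[]}     _                     p             i = gap-> (x<x+1 a) i
  sample-> {a} {w ∷ ws} ((a<w ∷ _) ∷ _)       zero          i = gap-> a<w i
  sample-> {a} {w ∷ ws} ((a<w ∷ _) ∷ _)       (suc zero)    i = a<w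
  sample-> {a} {w ∷ ws} ((a<w ∷ _) ∷ sorted) (suc (suc p)) i = <-trans a<w (sample-> sorted p i)

  position-sample : ∀ {a ws p} → AllPairs _<_ (a ∷ ws) → p ℕ.≤ double (length ws) → ∀ i → position ws (sample a ws p i) ≡ p
  position-sample {ws = []}     {zero}        _                 _ i = refl
  position-sample {ws = w ∷ ws} {zero}        ((a<w ∷ _) ∷ _) _ i rewrite <⇒less (gap-< a<w i) = refl
  position-sample {ws = w ∷ ws} {suc zero}    _                 _ i rewrite ≡⇒equal {w} refl = refl
  position-sample {ws = w ∷ ws} {suc (suc p)} (_ ∷ sorted) (s≤s (s≤s p≤)) i
    rewrite >⇒greater (sample-> sorted p i) = cong (suc ∘ suc) (position-sample sorted p≤ i)

  sample-even : ∀ {a ws} → AllPairs _<_ (a ∷ ws) → ∀ p → even p ≡ true → ∀ {i j} → i ℕ.< j → sample a ws p i < sample a ws p j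
  sample-even {a} {[]}     _                p             e i<j = gap-mono (x<x+1 a) i<j
  sample-even {a} {w ∷ ws} ((a<w ∷ _) ∷ _) zero          e i<j = gap-mono a<w i<j
  sample-even {a} {w ∷ ws} (_ ∷ sorted)    (suc (suc p)) e i<j = sample-even sorted p e i<j

  sample-cmp : ∀ {a ws} → AllPairs _<_ (a ∷ ws) → ∀ p → even p ≡ true → ∀ i j → cmp (sample a ws p i) (sample a ws p j) ≡ cmpℕ i j
  sample-cmp sorted p e i j with cmpℕ i j in c
  ... | less    = <⇒less (sample-even sorted p e (ℕᶜ.less⇒< c))
  ... | equal   rewrite ℕᶜ.equal⇒≡ c = ≡⇒equal refl
  ... | greater = >⇒greater (sample-even sorted p e (ℕᶜ.greater⇒> c))

  -- Supplies the real below all thresholds from which `sample` starts; without thresholds any real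
  -- will do.
  floor : List Carrier → Carrier
  floor []       = 0r
  floor (w ∷ ws) = w - 1r

  floor-sorted : ∀ {ws} → AllPairs _<_ ws → AllPairs _<_ (floor ws ∷ ws)
  floor-sorted []       = [] ∷ []
  floor-sorted {w ∷ ws} (p ∷ ps) = (x-1<x w ∷ All.map (<-trans (x-1<x w)) p) ∷ p ∷ ps

-- Ground terms, argument tuples and the search spaces.

_≟ᵍ_ : DecidableEquality GTerm
num p    ≟ᵍ num q    = map′ (cong num) (λ { refl → refl }) (p ℚ.≟ q)
skol k   ≟ᵍ skol l   = map′ (cong skol) (λ { refl → refl }) (k ℕ.≟ l)
(s ⊕ t)  ≟ᵍ (u ⊕ v)  = map′ (λ { (refl , refl) → refl }) (λ { refl → refl , refl }) (s ≟ᵍ u ×-dec t ≟ᵍ v)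
(s ⊖ t)  ≟ᵍ (u ⊖ v)  = map′ (λ { (refl , refl) → refl }) (λ { refl → refl , refl }) (s ≟ᵍ u ×-dec t ≟ᵍ v)
num _    ≟ᵍ skol _   = no λ ()
num _    ≟ᵍ (_ ⊕ _)  = no λ ()
num _    ≟ᵍ (_ ⊖ _)  = no λ ()
skol _   ≟ᵍ num _    = no λ ()
skol _   ≟ᵍ (_ ⊕ _)  = no λ ()
skol _   ≟ᵍ (_ ⊖ _)  = no λ ()
(_ ⊕ _)  ≟ᵍ num _    = no λ ()
(_ ⊕ _)  ≟ᵍ skol _   = no λ ()
(_ ⊕ _)  ≟ᵍ (_ ⊖ _)  = no λ ()
(_ ⊖ _)  ≟ᵍ num _    = no λ ()
(_ ⊖ _)  ≟ᵍ skol _   = no λ ()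
(_ ⊖ _)  ≟ᵍ (_ ⊕ _)  = no λ ()

module _ {Dom : Sort → Set} where

  bases : ∀ {ss} → All Dom ss → List (Dom base)
  bases []                    = []
  bases {base ∷ _} (x ∷ as) = x ∷ bases as
  bases {free ∷ _} (_ ∷ as) = bases as

  frees : ∀ {ss} → All Dom ss → List (Dom free)
  frees []                    = []
  frees {base ∷ _} (_ ∷ as) = frees as
  frees {free ∷ _} (x ∷ as) = x ∷ frees as

  -- missing arguments are filled with the given defaults
  build : Dom base → Dom free → ∀ ss → List (Dom base) → List (Dom free) → All Dom ss
  build b f []          _        _        = []
  build b f (base ∷ ss) []       fs       = b ∷ build b f ss [] fs
  build b f (base ∷ ss) (x ∷ xs) fs       = x ∷ build b f ss xs fs
  build b f (free ∷ ss) xs       []       = f ∷ build b f ss xs []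
  build b f (free ∷ ss) xs       (y ∷ fs) = y ∷ build b f ss xs fs

  -- Splitting by sort lets tables and colourings be indexed by two plain lists; this recovers the
  -- sorted tuple to which `predI` applies.
  build-split : ∀ b f {ss} (as : All Dom ss) → build b f ss (bases as) (frees as) ≡ as
  build-split b f []                    = refl
  build-split b f {base ∷ _} (x ∷ as) = cong (x ∷_) (build-split b f as)
  build-split b f {free ∷ _} (x ∷ as) = cong (x ∷_) (build-split b f as)

baseArity freeArity : List Sort → ℕ
baseArity []          = 0
baseArity (base ∷ ss) = suc (baseArity ss)
baseArity (free ∷ ss) = baseArity ss
freeArity []          = 0
freeArity (base ∷ ss) = freeArity ss
freeArity (free ∷ ss) = suc (freeArity ss)

length-bases : ∀ {Dom : Sort → Set} {ss} (as : All Dom ss) → length (bases as) ≡ baseArity ss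
length-bases []                    = refl
length-bases {ss = base ∷ _} (x ∷ as) = cong suc (length-bases as)
length-bases {ss = free ∷ _} (x ∷ as) = length-bases as

length-frees : ∀ {Dom : Sort → Set} {ss} (as : All Dom ss) → length (frees as) ≡ freeArity ss
length-frees []                    = refl
length-frees {ss = base ∷ _} (x ∷ as) = length-frees as
length-frees {ss = free ∷ _} (x ∷ as) = cong suc (length-frees as)

-- A normal form for positions together with relative order. Ranks are taken among the entries of
-- the tuple itself, so an atom gets the same key whatever other variables its clause contains, and
-- reals and abstract elements with the same positions and comparisons share a key.
canon : ∀ {X : Set} → (X → ℕ) → (X → X → Cmp) → List X → List Elt
canon pos c xs = map (λ x → pos x , rank c xs x) xs

relᵇ : Rel → Cmp → Bool
relᵇ lt less    = true
relᵇ lt _       = false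
relᵇ le greater = false
relᵇ le _       = true
relᵇ eq equal   = true
relᵇ eq _       = false
relᵇ ne equal   = false
relᵇ ne _       = true
relᵇ ge less    = false
relᵇ ge _       = true
relᵇ gt greater = true
relᵇ gt _       = false

constraintVars : Constraint → List ℕ
constraintVars (gg _ _ _) = []
constraintVars (vg x _ _) = x ∷ []
constraintVars (vv x _ y) = x ∷ y ∷ []

constraintTerms : Constraint → List GTerm
constraintTerms (gg s _ t) = s ∷ t ∷ []
constraintTerms (vg _ _ t) = t ∷ []
constraintTerms (vv _ _ _) = []

ascending : List GTerm → List Comparison
ascending []       = []
ascending (t ∷ ts) = map (λ u → true , t , u) ts ++ ascending ts

rep : List GTerm → (GTerm → ℕ) → GTerm → GTerm
rep reps ρ t = nth (num 0ℚ) reps (ρ t)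

-- The guessed order as a linear system: the representatives ascend strictly, and every ground term
-- equals the representative that `ρ` assigns to it, written as two weak inequalities.
comparisons : List GTerm → List GTerm → (GTerm → ℕ) → List Comparison
comparisons ts reps ρ = ascending reps ++ concatMap (λ t → (false , t , rep reps ρ t) ∷ (false , rep reps ρ t , t) ∷ []) ts

termElt : (GTerm → ℕ) → GTerm → Elt
termElt ρ t = suc (double (ρ t)) , 0

elements : ℕ → ℕ → List Elt
elements m K = cartesianProduct (upTo (suc (double m))) (upTo K)

module FunGTerm = FiniteFunctions {B = ℕ} _≟ᵍ_ 0
module FunElt = FiniteFunctions {B = Elt} ℕ._≟_ (0 , 0)
module FunFree (k : ℕ) = FiniteFunctions {B = Fin (suc k)} ℕ._≟_ Fin.zero
module FunConst (n k : ℕ) = FiniteFunctions {A = Fin n} {B = Fin (suc k)} Fin._≟_ Fin.zero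

-- The decision procedure.

module Procedure (σ : Signature) where

  atomBases : Atom σ → List ℕ
  atomBases (_ ≈ₐ _)    = []
  atomBases (pred p as) = bases as

  atomTerms : Atom σ → List (FTerm σ)
  atomTerms (s ≈ₐ t)    = s ∷ t ∷ []
  atomTerms (pred p as) = frees as

  termVars : FTerm σ → List ℕ
  termVars (fvar x)   = x ∷ []
  termVars (fconst _) = []

  baseVars : Clause σ → List ℕ
  baseVars (Λ ‖ Γ ⇒ Δ) = concatMap constraintVars Λ ++ concatMap atomBases (Γ ++ Δ)

  freeVars : Clause σ → List ℕ
  freeVars (Λ ‖ Γ ⇒ Δ) = concatMap (concatMap termVars ∘ atomTerms) (Γ ++ Δ)

  groundTerms : List (Clause σ) → List GTerm
  groundTerms N = concatMap (concatMap constraintTerms ∘ Clause.Λ) N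

  Key : ℕ → Set
  Key k = Fin (nPred σ) × List Elt × List (Fin (suc k))

  _≟ₖ_ : ∀ {k} → DecidableEquality (Key k)
  _≟ₖ_ = Productₚ.≡-dec Fin._≟_ (Productₚ.≡-dec (Listₚ.≡-dec (Productₚ.≡-dec ℕ._≟_ ℕ._≟_)) (Listₚ.≡-dec Fin._≟_))

  module FunKey (k : ℕ) = FiniteFunctions {B = Bool} (_≟ₖ_ {k}) false

  -- Two kinds of ranks serve as indices and must lie below this number: those among the base
  -- variables of a clause and those among the base arguments of an atom. The successor also makes
  -- it positive, so that index 0, used by `termElt`, always exists.
  width : List (Clause σ) → ℕ
  width N = suc (max 0 (map (length ∘ baseVars) N) ℕ.⊔ max 0 (map (baseArity ∘ arity σ) (allFin (nPred σ))))

  keys : ℕ → ℕ → (k : ℕ) → List (Key k)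
  keys m K k = concatMap (λ p → map (p ,_) (cartesianProduct (listsOf (baseArity (arity σ p)) (elements m K))
                                                       (listsOf (freeArity (arity σ p)) (allFin (suc k)))))
                         (allFin (nPred σ))

  module Evaluation (K : ℕ) (ρ : GTerm → ℕ) (k : ℕ) (constant : Fin (nConst σ) → Fin (suc k)) (table : Key k → Bool) where

    _≶ₑ_ : Elt → Elt → Cmp
    d ≶ₑ e = cmpℕ (flat K d) (flat K e)

    module _ (βb : ℕ → Elt) (βf : ℕ → Fin (suc k)) where

      constraintᵇ : Constraint → Bool
      constraintᵇ (gg s r t) = relᵇ r (termElt ρ s ≶ₑ termElt ρ t)
      constraintᵇ (vg x r t) = relᵇ r (βb x ≶ₑ termElt ρ t)
      constraintᵇ (vv x r y) = relᵇ r (βb x ≶ₑ βb y)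

      term : FTerm σ → Fin (suc k)
      term (fvar x)   = βf x
      term (fconst c) = constant c

      key : (p : Fin (nPred σ)) → All (Arg σ) (arity σ p) → Key k
      key p as = p , canon (proj₁ ∘ βb) (λ x y → βb x ≶ₑ βb y) (bases as) , map term (frees as)

      atomᵇ : Atom σ → Bool
      atomᵇ (s ≈ₐ t)    = does (term s Fin.≟ term t)
      atomᵇ (pred p as) = table (key p as)

      clauseᵇ : Clause σ → Bool
      clauseᵇ (Λ ‖ Γ ⇒ Δ) = if all constraintᵇ Λ ∧ all atomᵇ Γ then any atomᵇ Δ else true

    check : ℕ → Clause σ → Bool
    check m C = all (λ βb → all (λ βf → clauseᵇ βb βf C) (FunFree.functions k (freeVars C) (allFin (suc k))))
                    (FunElt.functions (baseVars C) (elements m K))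

  -- Lists with repetitions or in an impossible order are included; `feasible` rejects them, because
  -- `comparisons` asks for strict ascent.
  orderings : List GTerm → List (List GTerm)
  orderings ts = concatMap (λ n → listsOf n ts) (upTo (suc (length ts)))

  -- The free sort is `Fin (suc k)`: up to one element per constant, and one more since the sort is
  -- nonempty even without constants.
  uniformModelExists : List (Clause σ) → (GTerm → ℕ) → ℕ → Bool
  uniformModelExists N ρ m =
    any (λ k → any (λ c → any (λ table → all (Evaluation.check (width N) ρ k c table m) N)
                              (FunKey.functions k (keys m (width N) k) (true ∷ false ∷ [])))
                   (FunConst.functions (nConst σ) k (allFin (nConst σ)) (allFin (suc k))))
        (upTo (suc (nConst σ)))

  decideWith : List (Clause σ) → List GTerm → (GTerm → ℕ) → Bool
  decideWith N reps ρ = feasible (comparisons (groundTerms N) reps ρ) ∧ uniformModelExists N ρ (length reps)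

  decide : List (Clause σ) → Bool
  decide N = any (λ reps → any (decideWith N reps) (FunGTerm.functions (groundTerms N) (upTo (length reps))))
                 (orderings (groundTerms N))

-- Auxiliary facts on Boolean search and canonical forms.

any-true⇒∃ : ∀ {a} {A : Set a} {p : A → Bool} xs → any p xs ≡ true → ∃ λ x → x ∈ xs × p x ≡ true
any-true⇒∃ {p = p} (x ∷ xs) e with p x in px
... | true  = x , here refl , px
... | false with any-true⇒∃ xs e
...   | y , y∈ , py = y , there y∈ , py

∃⇒any-true : ∀ {a} {A : Set a} {p : A → Bool} {x xs} → x ∈ xs → p x ≡ true → any p xs ≡ true
∃⇒any-true {p = p} {xs = x ∷ xs} (here refl) px rewrite px = refl
∃⇒any-true {p = p} {xs = y ∷ xs} (there x∈)  px with p y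
... | true  = refl
... | false = ∃⇒any-true x∈ px

∧-true : ∀ {a b} → a ∧ b ≡ true → a ≡ true × b ≡ true
∧-true {true} {true} _ = refl , refl

true-∧ : ∀ {a b} → a ≡ true → b ≡ true → a ∧ b ≡ true
true-∧ refl refl = refl

∈-concatMap : ∀ {A B : Set} (f : A → List B) {x y xs} → x ∈ xs → y ∈ f x → y ∈ concatMap f xs
∈-concatMap f x∈ y∈ = ∈-concatMap⁺ f (lose x∈ y∈)

canon-map : ∀ {X Y : Set} (pos : Y → ℕ) (c : Y → Y → Cmp) (f : X → Y) xs →
            canon pos c (map f xs) ≡ canon (pos ∘ f) (λ x y → c (f x) (f y)) xs
canon-map pos c f xs = trans (sym (Listₚ.map-∘ xs)) (Listₚ.map-cong (λ x → cong (pos (f x) ,_) (rank-map f xs x)) xs)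

map-cong-∈ : ∀ {a b} {A : Set a} {B : Set b} {f g : A → B} xs → (∀ {x} → x ∈ xs → f x ≡ g x) → map f xs ≡ map g xs
map-cong-∈ []       h = refl
map-cong-∈ (x ∷ xs) h = cong₂ _∷_ (h (here refl)) (map-cong-∈ xs (h ∘ there))

canon-cong : ∀ {X : Set} {pos pos′ : X → ℕ} {c c′ : X → X → Cmp} xs → (∀ {x} → x ∈ xs → pos x ≡ pos′ x) →
             (∀ {x y} → x ∈ xs → y ∈ xs → c x y ≡ c′ x y) → canon pos c xs ≡ canon pos′ c′ xs
canon-cong xs hp hc = map-cong-∈ xs (λ x∈ → cong₂ _,_ (hp x∈) (rank-cong xs (λ y∈ → hc y∈ x∈)))

∈-elements : ∀ {m K p i} → p ℕ.≤ double m → i ℕ.< K → (p , i) ∈ elements m K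
∈-elements p≤ i< = ∈-cartesianProduct⁺ (∈-upTo⁺ (s≤s p≤)) (∈-upTo⁺ i<)

elements-bound : ∀ {m K} d → d ∈ elements m K → proj₁ d ℕ.≤ double m × proj₂ d ℕ.< K
elements-bound {m} {K} d d∈ with ∈-cartesianProduct⁻ (upTo (suc (double m))) (upTo K) d∈
... | p∈ , i∈ = ℕₚ.≤-pred (∈-upTo⁻ p∈) , ∈-upTo⁻ i∈

module _ (σ : Signature) where
  open Procedure σ

  private
    bounded : ∀ {A : Set} (f : A → ℕ) {x xs} → x ∈ xs → f x ℕ.≤ max 0 (map f xs)
    bounded f {xs = xs} x∈ = All.lookup (xs≤max 0 (map f xs)) (∈-map⁺ f x∈)

  baseVars<width : ∀ {N C} → C ∈ N → length (baseVars C) ℕ.< width N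
  baseVars<width C∈ = s≤s (ℕₚ.≤-trans (bounded (length ∘ baseVars) C∈) (ℕₚ.m≤m⊔n _ _))

  arity<width : ∀ N p → baseArity (arity σ p) ℕ.< width N
  arity<width N p = s≤s (ℕₚ.≤-trans (bounded (baseArity ∘ arity σ) (∈-allFin p)) (ℕₚ.m≤n⊔m (max 0 (map (length ∘ baseVars) N)) _))

-- Abstract evaluation compared with the semantics.

module Evaluated (R : RealField) (σ : Signature) (𝒜 : Semantics.Interpretation R σ) where
  open RealField R
  open OrderedField R
  open RealPositions R
  open Semantics R σ
  open Interpretation 𝒜
  open FourierMotzkin R using (evalTerm)

  evalG≡evalTerm : ∀ t → evalG 𝒜 t ≡ evalTerm skolemI t
  evalG≡evalTerm (num q)  = refl
  evalG≡evalTerm (skol k) = refl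
  evalG≡evalTerm (s ⊕ t)  = cong₂ _+_ (evalG≡evalTerm s) (evalG≡evalTerm t)
  evalG≡evalTerm (s ⊖ t)  = cong₂ _-_ (evalG≡evalTerm s) (evalG≡evalTerm t)

  bases-evalArgs : ∀ βb βf {ss} (as : All (Arg σ) ss) → bases (evalArgs 𝒜 βb βf as) ≡ map βb (bases as)
  bases-evalArgs βb βf []                    = refl
  bases-evalArgs βb βf {base ∷ _} (x ∷ as) = cong (βb x ∷_) (bases-evalArgs βb βf as)
  bases-evalArgs βb βf {free ∷ _} (x ∷ as) = bases-evalArgs βb βf as

  frees-evalArgs : ∀ βb βf {ss} (as : All (Arg σ) ss) → frees (evalArgs 𝒜 βb βf as) ≡ map (evalF 𝒜 βb βf) (frees as)
  frees-evalArgs βb βf []                    = refl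
  frees-evalArgs βb βf {base ∷ _} (x ∷ as) = frees-evalArgs βb βf as
  frees-evalArgs βb βf {free ∷ _} (t ∷ as) = cong (evalF 𝒜 βb βf t ∷_) (frees-evalArgs βb βf as)

  rel-complete : ∀ r {x y} → holdsRel 𝒜 r x y → relᵇ r (cmp x y) ≡ true
  rel-complete lt x<y                 rewrite <⇒less x<y = refl
  rel-complete le (inj₁ x<y)          rewrite <⇒less x<y = refl
  rel-complete le (inj₂ x≡y)          rewrite ≡⇒equal x≡y = refl
  rel-complete eq x≡y                 rewrite ≡⇒equal x≡y = refl
  rel-complete ne {x} {y} x≢y with cmp x y in e
  ... | less    = refl
  ... | equal   = contradiction (equal⇒≡ e) x≢y
  ... | greater = refl
  rel-complete ge (inj₁ y<x)          rewrite >⇒greater y<x = refl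
  rel-complete ge (inj₂ y≡x)          rewrite ≡⇒equal (sym y≡x) = refl
  rel-complete gt y<x                 rewrite >⇒greater y<x = refl

  rel-sound : ∀ r {x y} → relᵇ r (cmp x y) ≡ true → holdsRel 𝒜 r x y
  rel-sound r {x} {y} h with cmp x y in e
  rel-sound lt h | less    = less⇒< e
  rel-sound le h | less    = inj₁ (less⇒< e)
  rel-sound le h | equal   = inj₂ (equal⇒≡ e)
  rel-sound eq h | equal   = equal⇒≡ e
  rel-sound ne h | less    = λ x≡y → <-irrefl x≡y (less⇒< e)
  rel-sound ne h | greater = λ x≡y → <-irrefl (sym x≡y) (greater⇒> e)
  rel-sound ge h | equal   = inj₂ (sym (equal⇒≡ e))
  rel-sound ge h | greater = inj₁ (greater⇒> e)
  rel-sound gt h | greater = greater⇒> e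

  -- `located` and `agrees` are all that a constraint can see of an assignment. Soundness gets them
  -- by computing `fb` from reals, completeness by computing `βb` from abstract elements, so both
  -- directions share this module.
  module Agreement
    {K : ℕ} (0<K : 0 ℕ.< K) {ρ : GTerm → ℕ} {ws : List Carrier} (sorted : AllPairs _<_ ws) {ts : List GTerm}
    (represents : ∀ {t} → t ∈ ts → ρ t ℕ.< length ws × nth 0r ws (ρ t) ≡ evalG 𝒜 t)
    {k : ℕ} {constant : Fin (nConst σ) → Fin (suc k)} {table : Procedure.Key σ k → Bool}
    {xs : List ℕ} {βb : ℕ → Carrier} {βf : ℕ → S} {fb : ℕ → Elt} {ff : ℕ → Fin (suc k)}
    (located : ∀ {x} → x ∈ xs → proj₁ (fb x) ≡ position ws (βb x) × proj₂ (fb x) ℕ.< K)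
    (agrees : ∀ {x y} → x ∈ xs → y ∈ xs → cmpℕ (flat K (fb x)) (flat K (fb y)) ≡ cmp (βb x) (βb y))
    where
    open Procedure.Evaluation σ K ρ k constant table

    private
      threshold : ∀ {x i t} → i ℕ.< K → t ∈ ts → cmpℕ (flat K (position ws x , i)) (flat K (termElt ρ t)) ≡ cmp x (evalG 𝒜 t)
      threshold {x} {i} {t} i<K t∈ with represents t∈
      ... | ρt< , ev = trans (cong (λ p → cmpℕ (flat K (position ws x , i)) (flat K (p , 0))) (sym (position-nth 0r sorted ρt<)))
          -- `termElt` sits at an odd position, so the case of two elements in a common gap cannot
          -- occur.
          (trans (cmp-flat ws i<K 0<K λ same e → contradiction
                    (trans (sym (even-1+double (ρ t))) (trans (cong even (trans (sym (position-nth 0r sorted ρt<)) (sym same))) e)) λ ())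
                 (cong (cmp x) ev))

      constraint : ∀ c → All (_∈ xs) (constraintVars c) → All (_∈ ts) (constraintTerms c) →
        Σ Rel λ r → Σ (Carrier × Carrier) λ { (a , b) →
          (constraintᵇ fb ff c ≡ relᵇ r (cmp a b)) × (evalC 𝒜 βb βf c ≡ holdsRel 𝒜 r a b) }
      constraint (gg s r t) _ (s∈ ∷ t∈ ∷ []) = r , (evalG 𝒜 s , evalG 𝒜 t) , cong (relᵇ r) termTerm , refl
        where
        termTerm : cmpℕ (flat K (termElt ρ s)) (flat K (termElt ρ t)) ≡ cmp (evalG 𝒜 s) (evalG 𝒜 t)
        termTerm with represents s∈
        ... | ρs< , ev = trans (cong (λ p → cmpℕ (flat K (p , 0)) (flat K (termElt ρ t)))
                                  (trans (sym (position-nth 0r sorted ρs<)) (cong (position ws) ev)))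
                               (threshold 0<K t∈)
      constraint (vg x r t) (x∈ ∷ []) (t∈ ∷ []) = r , (βb x , evalG 𝒜 t) , cong (relᵇ r) varTerm , refl
        where
        varTerm : cmpℕ (flat K (fb x)) (flat K (termElt ρ t)) ≡ cmp (βb x) (evalG 𝒜 t)
        varTerm = trans (cong (λ p → cmpℕ (flat K (p , proj₂ (fb x))) (flat K (termElt ρ t))) (proj₁ (located x∈)))
                        (threshold (proj₂ (located x∈)) t∈)
      constraint (vv x r y) (x∈ ∷ y∈ ∷ []) _ = r , (βb x , βb y) , cong (relᵇ r) (agrees x∈ y∈) , refl

    constraint-sound : ∀ c → All (_∈ xs) (constraintVars c) → All (_∈ ts) (constraintTerms c) →
                       constraintᵇ fb ff c ≡ true → evalC 𝒜 βb βf c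
    constraint-sound c x∈ t∈ h with constraint c x∈ t∈
    ... | r , _ , e₁ , e₂ rewrite e₂ = rel-sound r (trans (sym e₁) h)

    constraint-complete : ∀ c → All (_∈ xs) (constraintVars c) → All (_∈ ts) (constraintTerms c) →
                          evalC 𝒜 βb βf c → constraintᵇ fb ff c ≡ true
    constraint-complete c x∈ t∈ h with constraint c x∈ t∈
    ... | r , _ , e₁ , e₂ rewrite e₂ = trans e₁ (rel-complete r h)

-- Soundness: a positive verdict yields a model.

module Soundness (R : RealField) (σ : Signature) where
  open RealField R
  open OrderedField R
  open RealPositions R
  open Semantics R σ
  open FourierMotzkin R using (evalTerm; HoldsComparison; feasible-sound)
  open Procedure σ

  ascending-sound : ∀ v reps → All (HoldsComparison v) (ascending reps) → AllPairs _<_ (map (evalTerm v) reps)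
  ascending-sound v []         _ = []
  ascending-sound v (t ∷ reps) h =
    Allₚ.map⁺ (Allₚ.map⁻ (Allₚ.++⁻ˡ (map (λ u → true , t , u) reps) h)) ∷ ascending-sound v reps (Allₚ.++⁻ʳ (map _ reps) h)

  ≤-antisym : ∀ {x y} → x ≤ y → y ≤ x → x ≡ y
  ≤-antisym (inj₁ p) q = contradiction (<-≤-trans p q) (<-irrefl refl)
  ≤-antisym (inj₂ e) q = e

  module _ (N : List (Clause σ)) (reps : List GTerm) (ρ : GTerm → ℕ) (v : ℕ → Carrier)
    (holds : All (HoldsComparison v) (comparisons (groundTerms N) reps ρ))
    (ρ< : ∀ {t} → t ∈ groundTerms N → ρ t ℕ.< length reps)
    (k : ℕ) (constant : Fin (nConst σ) → Fin (suc k)) (table : Key k → Bool) where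

    ws : List Carrier
    ws = map (evalTerm v) reps

    sorted : AllPairs _<_ ws
    sorted = ascending-sound v reps (Allₚ.++⁻ˡ (ascending reps) holds)

    -- The finite table is spread over all real tuples: a tuple is looked up under its own canonical
    -- form relative to the thresholds.
    uniformModel : Interpretation
    uniformModel = record
      { skolemI = v
      ; S       = Fin (suc k)
      ; inhabit = Fin.zero
      ; constI  = constant
      ; predI   = λ p as → table (p , canon (position ws) cmp (bases as) , frees as) ≡ true
      }

    open Evaluated R σ uniformModel
    open Evaluation (width N) ρ k constant table

    represents : ∀ {t} → t ∈ groundTerms N → ρ t ℕ.< length ws × nth 0r ws (ρ t) ≡ evalG uniformModel t
    represents {t} t∈ = subst (ρ t ℕ.<_) (sym (Listₚ.length-map (evalTerm v) reps)) (ρ< t∈) ,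
      trans (nth-map (evalTerm v) (num 0ℚ) 0r reps (ρ< t∈))
        (trans (≤-antisym (All.lookup holds (∈-++⁺ʳ (ascending reps) (∈-concatMap _ t∈ (there (here refl)))))
                          (All.lookup holds (∈-++⁺ʳ (ascending reps) (∈-concatMap _ t∈ (here refl)))))
               (sym (evalG≡evalTerm t)))

    module Assignment (Λ : List Constraint) (Γ Δ : List (Atom σ)) (C∈ : (Λ ‖ Γ ⇒ Δ) ∈ N) (βb : ℕ → Carrier) (βf : ℕ → Fin (suc k)) where

      xs : List ℕ
      xs = baseVars (Λ ‖ Γ ⇒ Δ)

      _≶_ : ℕ → ℕ → Cmp
      x ≶ y = cmp (βb x) (βb y)

      rank< : ∀ x → rank _≶_ xs x ℕ.< width N
      rank< x = ℕₚ.≤-<-trans (rank≤length _≶_ xs x) (baseVars<width σ C∈)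

      -- The abstract imitation of `βb`: the index of a variable is its rank among the base
      -- variables of the clause, which keeps all comparisons and stays below `width N`.
      g : ℕ → Elt
      g x = position ws (βb x) , rank _≶_ xs x

      g∈ : ∀ {x} → x ∈ xs → g x ∈ elements (length reps) (width N)
      g∈ {x} _ = ∈-elements (subst (λ n → position ws (βb x) ℕ.≤ double n) (Listₚ.length-map (evalTerm v) reps) (position-bound ws (βb x))) (rank< x)
      module _ (fb : ℕ → Elt) (ff : ℕ → Fin (suc k)) (fb≡g : ∀ {x} → x ∈ xs → fb x ≡ g x)
               (ff≡βf : ∀ {x} → x ∈ freeVars (Λ ‖ Γ ⇒ Δ) → ff x ≡ βf x) where

        agrees : ∀ {x y} → x ∈ xs → y ∈ xs → cmpℕ (flat (width N) (fb x)) (flat (width N) (fb y)) ≡ cmp (βb x) (βb y)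
        agrees {x} {y} x∈ y∈ = trans (cong₂ (λ d e → cmpℕ (flat (width N) d) (flat (width N) e)) (fb≡g x∈) (fb≡g y∈))
          (cmp-flat ws (rank< x) (rank< y) (λ _ _ → RankComparing.cmp-rank isStrictTotalOrder βb x∈ y∈))

        located : ∀ {x} → x ∈ xs → proj₁ (fb x) ≡ position ws (βb x) × proj₂ (fb x) ℕ.< width N
        located {x} x∈ = cong proj₁ (fb≡g x∈) , subst (ℕ._< width N) (sym (cong proj₂ (fb≡g x∈))) (rank< x)
        term≡ : ∀ {a t} → a ∈ Γ ++ Δ → t ∈ atomTerms a → term fb ff t ≡ evalF uniformModel βb βf t
        term≡ {t = fvar x}   a∈ t∈ = ff≡βf (∈-concatMap _ a∈ (∈-concatMap termVars t∈ (here refl)))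
        term≡ {t = fconst c} a∈ t∈ = refl

        -- A key depends on positions and comparisons only, and both are the same for `fb` and `βb`.
        key≡ : ∀ {p as} → pred p as ∈ Γ ++ Δ → key fb ff p as ≡
               (p , canon (position ws) cmp (bases (evalArgs uniformModel βb βf as)) , frees (evalArgs uniformModel βb βf as))
        key≡ {p} {as} a∈ = cong (p ,_) (cong₂ _,_
          (trans (canon-cong (bases as) (λ x∈ → cong proj₁ (fb≡g (var∈ x∈))) (λ x∈ y∈ → agrees (var∈ x∈) (var∈ y∈)))
            (trans (sym (canon-map (position ws) cmp βb (bases as))) (cong (canon (position ws) cmp) (sym (bases-evalArgs βb βf as)))))
          (trans (map-cong-∈ (frees as) (term≡ a∈)) (sym (frees-evalArgs βb βf as))))
          where
          var∈ : ∀ {x} → x ∈ bases as → x ∈ xs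
          var∈ x∈ = ∈-++⁺ʳ (concatMap constraintVars Λ) (∈-concatMap atomBases a∈ x∈)
        atom-complete : ∀ a → a ∈ Γ ++ Δ → evalA uniformModel βb βf a → atomᵇ fb ff a ≡ true
        atom-complete (s ≈ₐ t)    a∈ h = dec-true (term fb ff s Fin.≟ term fb ff t)
          (trans (term≡ a∈ (here refl)) (trans h (sym (term≡ a∈ (there (here refl))))))
        atom-complete (pred p as) a∈ h = trans (cong table (key≡ a∈)) h

        atom-sound : ∀ a → a ∈ Γ ++ Δ → atomᵇ fb ff a ≡ true → evalA uniformModel βb βf a
        atom-sound (s ≈ₐ t)    a∈ h = trans (sym (term≡ a∈ (here refl)))
          (trans (does-true (term fb ff s Fin.≟ term fb ff t) h) (term≡ a∈ (there (here refl))))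
        atom-sound (pred p as) a∈ h = trans (cong table (sym (key≡ a∈))) h
        constraints : All (evalC uniformModel βb βf) Λ → all (constraintᵇ fb ff) Λ ≡ true
        constraints hΛ = All⇒all-true (All.tabulate λ {c} c∈ → Agreement.constraint-complete
          (s≤s z≤n) sorted represents {constant = constant} {table = table} {βf = βf} {ff = ff} located agrees c
          (All.tabulate λ x∈ → ∈-++⁺ˡ (∈-concatMap constraintVars c∈ x∈))
          (All.tabulate λ t∈ → ∈-concatMap (concatMap constraintTerms ∘ Clause.Λ) C∈ (∈-concatMap constraintTerms c∈ t∈))
          (All.lookup hΛ c∈))
        conclusion : clauseᵇ fb ff (Λ ‖ Γ ⇒ Δ) ≡ true → All (evalC uniformModel βb βf) Λ → All (evalA uniformModel βb βf) Γ →
                     Any (evalA uniformModel βb βf) Δ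
        conclusion ok hΛ hΓ = lose (proj₁ (proj₂ witness)) (atom-sound (proj₁ witness) (∈-++⁺ʳ Γ (proj₁ (proj₂ witness))) (proj₂ (proj₂ witness)))
          where
          premises : all (atomᵇ fb ff) Γ ≡ true
          premises = All⇒all-true (All.tabulate λ {a} a∈ → atom-complete a (∈-++⁺ˡ a∈) (All.lookup hΓ a∈))
          disjunction : any (atomᵇ fb ff) Δ ≡ true
          disjunction = subst (λ b → (if b then any (atomᵇ fb ff) Δ else true) ≡ true) (true-∧ (constraints hΛ) premises) ok
          witness : ∃ λ a → a ∈ Δ × atomᵇ fb ff a ≡ true
          witness = any-true⇒∃ Δ disjunction
    isModelOf : ∀ C → C ∈ N → check (length reps) C ≡ true → ModelOfClause uniformModel C
    isModelOf C@(Λ ‖ Γ ⇒ Δ) C∈ ok βb βf = conclusion fb ff (proj₂ (proj₂ base-assignment)) (proj₂ (proj₂ free-assignment))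
        (All.lookup (all-true⇒All (FunFree.functions k (freeVars C) (allFin (suc k)))
          (All.lookup (all-true⇒All (FunElt.functions (baseVars C) (elements (length reps) (width N))) ok) (proj₁ (proj₂ base-assignment))))
          (proj₁ (proj₂ free-assignment)))
      where
      open Assignment Λ Γ Δ C∈ βb βf
      base-assignment : ∃ λ f → f ∈ FunElt.functions (baseVars C) (elements (length reps) (width N)) × (∀ {x} → x ∈ baseVars C → f x ≡ g x)
      base-assignment = FunElt.functions-complete (baseVars C) g g∈
      free-assignment : ∃ λ f → f ∈ FunFree.functions k (freeVars C) (allFin (suc k)) × (∀ {x} → x ∈ freeVars C → f x ≡ βf x)
      free-assignment = FunFree.functions-complete k (freeVars C) βf (λ {x} _ → ∈-allFin (βf x))
      fb = proj₁ base-assignment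
      ff = proj₁ free-assignment

  sound : ∀ N → decide N ≡ true → Satisfiable N
  sound N h =
    let reps , _ , h₁     = any-true⇒∃ (orderings (groundTerms N)) h
        ρ , ρ∈ , h₂       = any-true⇒∃ (FunGTerm.functions (groundTerms N) (upTo (length reps))) h₁
        h₃ , h₄           = ∧-true {feasible (comparisons (groundTerms N) reps ρ)} h₂
        v , holds         = feasible-sound (comparisons (groundTerms N) reps ρ) h₃
        k , _ , h₅        = any-true⇒∃ (upTo (suc (nConst σ))) h₄
        constant , _ , h₆ = any-true⇒∃ (FunConst.functions (nConst σ) k (allFin (nConst σ)) (allFin (suc k))) h₅
        table , _ , h₇    = any-true⇒∃ (FunKey.functions k (keys (length reps) (width N) k) (true ∷ false ∷ [])) h₆
        ρ< : ∀ {t} → t ∈ groundTerms N → ρ t ℕ.< length reps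
        ρ< t∈ = ∈-upTo⁻ (FunGTerm.functions-range (groundTerms N) ρ∈ t∈)
    in uniformModel N reps ρ v holds ρ< k constant table ,
       All.tabulate (λ {C} C∈ → isModelOf N reps ρ v holds ρ< k constant table C C∈ (All.lookup (all-true⇒All N h₇) C∈))

-- Equality on the free sort need not be decidable, so representatives of the constants exist only up to double negation.
record Representatives {S : Set} {n : ℕ} (c : Fin n → S) : Set where
  field
    size       : ℕ
    size≤      : size ℕ.≤ n
    element    : Fin (suc size) → S
    injective  : ∀ {i j} → element i ≡ element j → i ≡ j
    constant   : Fin n → Fin (suc size)
    constant≡  : ∀ i → element (constant i) ≡ c i

-- The given element `x₀` is the first representative; constants are then added one by one, each
-- either equal to an earlier representative or fresh.
representatives : ∀ {S : Set} → S → ∀ n (c : Fin n → S) → ¬ ¬ Representatives c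
representatives x₀ zero c ¬r = ¬r record
  { size = 0 ; size≤ = z≤n ; element = λ _ → x₀ ; injective = λ { {Fin.zero} {Fin.zero} _ → refl }
  ; constant = λ () ; constant≡ = λ () }
-- Whether the new constant is fresh is not decided: refuting the case `old` for every index is
-- exactly the freshness that `new` asks for.
representatives {S} x₀ (suc n) c ¬r = representatives x₀ n (c ∘ Fin.suc) λ r → ¬r (new r λ i∃ → ¬r (old r i∃))
  where
  old : (r : Representatives (c ∘ Fin.suc)) → ∃ (λ i → Representatives.element r i ≡ c Fin.zero) → Representatives c
  old r (i , e) = record
    { size = size ; size≤ = ℕₚ.m≤n⇒m≤1+n size≤ ; element = element ; injective = injective
    ; constant  = λ { Fin.zero → i ; (Fin.suc j) → constant j }
    ; constant≡ = λ { Fin.zero → e ; (Fin.suc j) → constant≡ j } }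
    where open Representatives r
  new : (r : Representatives (c ∘ Fin.suc)) → ¬ ∃ (λ i → Representatives.element r i ≡ c Fin.zero) → Representatives c
  new r fresh = record
    { size = suc size ; size≤ = s≤s size≤ ; element = element′ ; injective = injective′
    ; constant  = λ { Fin.zero → Fin.zero ; (Fin.suc j) → Fin.suc (constant j) }
    ; constant≡ = λ { Fin.zero → refl ; (Fin.suc j) → constant≡ j } }
    where
    open Representatives r
    element′ : Fin (suc (suc size)) → S
    element′ Fin.zero    = c Fin.zero
    element′ (Fin.suc i) = element i
    injective′ : ∀ {i j} → element′ i ≡ element′ j → i ≡ j
    injective′ {Fin.zero}  {Fin.zero}  e = refl
    injective′ {Fin.zero}  {Fin.suc j} e = contradiction (j , sym e) fresh
    injective′ {Fin.suc i} {Fin.zero}  e = contradiction (i , e) fresh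
    injective′ {Fin.suc i} {Fin.suc j} e = cong Fin.suc (injective e)

zipWith-map : ∀ {A B C D : Set} (g : B → C → D) (u : A → B) (w : A → C) xs →
              zipWith g (map u xs) (map w xs) ≡ map (λ x → g (u x) (w x)) xs
zipWith-map g u w []       = refl
zipWith-map g u w (x ∷ xs) = cong (g (u x) (w x) ∷_) (zipWith-map g u w xs)

¬¬-All : ∀ {A : Set} {P : A → Set} xs → (∀ {x} → x ∈ xs → ¬ ¬ P x) → ¬ ¬ All P xs
¬¬-All []       h ¬all = ¬all []
¬¬-All (x ∷ xs) h ¬all = h (here refl) λ px → ¬¬-All xs (h ∘ there) λ pxs → ¬all (px ∷ pxs)

bool-∈ : ∀ b → b ∈ true ∷ false ∷ []
bool-∈ true  = here refl
bool-∈ false = there (here refl)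

-- Thresholds and truth values in a given model.

module Thresholds (R : RealField) where
  open RealField R
  open OrderedField R
  open RealPositions R

  record Ordering {A : Set} (value : A → Carrier) (ts : List A) : Set where
    field
      reps       : List A
      increasing : AllPairs (λ s t → value s < value t) reps
      reps⊆      : ∀ {t} → t ∈ reps → t ∈ ts
      short      : length reps ℕ.≤ length ts
      covers     : ∀ {t} → t ∈ ts → value t ∈ map value reps

  module _ {A : Set} (value : A → Carrier) where

    insertRep : ∀ t rs → AllPairs (λ s t → value s < value t) rs →
      Σ (List A) λ qs → AllPairs (λ s t → value s < value t) qs × (∀ {u} → u ∈ qs → u ∈ t ∷ rs) ×
        length qs ℕ.≤ suc (length rs) × (∀ {u} → u ∈ t ∷ rs → value u ∈ map value qs)
    insertRep t [] _ = t ∷ [] , [] ∷ [] , id , ℕₚ.≤-refl , λ { (here refl) → here refl }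
    insertRep t (r ∷ rs) (p ∷ ps) with cmp (value t) (value r) in e
    ... | less    = t ∷ r ∷ rs , (less⇒< e ∷ All.map (<-trans (less⇒< e)) p) ∷ p ∷ ps , id , ℕₚ.≤-refl , ∈-map⁺ value
    ... | equal   = r ∷ rs , p ∷ ps , there , ℕₚ.n≤1+n _ , λ { (here refl) → here (equal⇒≡ e) ; (there u∈) → ∈-map⁺ value u∈ }
    ... | greater with insertRep t rs ps
    ...   | qs , inc , qs⊆ , sh , cov = r ∷ qs , All.tabulate (λ u∈ → above (qs⊆ u∈)) ∷ inc
        , (λ { (here refl) → there (here refl) ; (there u∈) → skip (qs⊆ u∈) }) , s≤s sh
        , (λ { (here refl) → there (cov (here refl)) ; (there (here refl)) → here refl ; (there (there u∈)) → there (cov (there u∈)) })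
      where
      above : ∀ {u} → u ∈ t ∷ rs → value r < value u
      above (here refl) = greater⇒> e
      above (there u∈)  = All.lookup p u∈
      skip : ∀ {u} → u ∈ t ∷ rs → u ∈ t ∷ r ∷ rs
      skip (here refl) = here refl
      skip (there u∈)  = there (there u∈)

    order : ∀ ts → Ordering value ts
    order []       = record { reps = [] ; increasing = [] ; reps⊆ = id ; short = z≤n ; covers = λ () }
    order (t ∷ ts) with order ts
    ... | o with insertRep t (Ordering.reps o) (Ordering.increasing o)
    ...   | qs , inc , qs⊆ , sh , cov = record
      { reps       = qs
      ; increasing = inc
      ; reps⊆      = λ u∈ → back (qs⊆ u∈)
      ; short      = ℕₚ.≤-trans sh (s≤s (Ordering.short o))
      ; covers     = λ { (here refl) → cov (here refl) ; (there u∈) → onward (Ordering.covers o u∈) }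
      }
      where
      back : ∀ {u} → u ∈ t ∷ Ordering.reps o → u ∈ t ∷ ts
      back (here refl) = here refl
      back (there u∈)  = there (Ordering.reps⊆ o u∈)
      onward : ∀ {x} → x ∈ map value (Ordering.reps o) → x ∈ map value qs
      onward x∈ with ∈-map⁻ value x∈
      ... | u , u∈ , refl = cov (there u∈)

  indexOf : List Carrier → Carrier → ℕ
  indexOf []       x = 0
  indexOf (w ∷ ws) x with cmp x w
  ... | equal   = 0
  ... | less    = suc (indexOf ws x)
  ... | greater = suc (indexOf ws x)

  indexOf-spec : ∀ {ws x} → x ∈ ws → indexOf ws x ℕ.< length ws × nth 0r ws (indexOf ws x) ≡ x
  indexOf-spec {w ∷ ws} {x} x∈ with cmp x w in e
  indexOf-spec {w ∷ ws} {x} x∈          | equal   = s≤s z≤n , sym (equal⇒≡ e)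
  indexOf-spec {w ∷ ws} {x} (here refl) | less    = contradiction (less⇒< e) (<-irrefl refl)
  indexOf-spec {w ∷ ws} {x} (there x∈)  | less    = let i< , n≡ = indexOf-spec x∈ in s≤s i< , n≡
  indexOf-spec {w ∷ ws} {x} (here refl) | greater = contradiction (greater⇒> e) (<-irrefl refl)
  indexOf-spec {w ∷ ws} {x} (there x∈)  | greater = let i< , n≡ = indexOf-spec x∈ in s≤s i< , n≡

  -- A Boolean for `¬ ¬ Q` rather than `Q`, since only negated propositions are decided by `¬-dec`.
  truth : Set → Bool
  truth Q = not (does (¬-dec Q))

  truth-sound : ∀ {Q} → truth Q ≡ true → ¬ ¬ Q
  truth-sound {Q} e with ¬-dec Q
  ... | no ¬¬q = ¬¬q

  truth-complete : ∀ {Q} → Q → truth Q ≡ true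
  truth-complete {Q} q with ¬-dec Q
  ... | yes ¬q = contradiction q ¬q
  ... | no  _  = refl

-- Completeness: a model leads to a positive verdict.

module Completeness (R : RealField) (σ : Signature) (𝒜 : Semantics.Interpretation R σ) (N : List (Clause σ)) where
  open RealField R
  open OrderedField R
  open RealPositions R
  open Thresholds R
  open Semantics R σ
  open Interpretation 𝒜
  open Evaluated R σ 𝒜
  open FourierMotzkin R using (evalTerm; HoldsComparison; feasible-complete)
  open Procedure σ

  ascending-complete : ∀ v reps → AllPairs (λ s t → evalTerm v s < evalTerm v t) reps → All (HoldsComparison v) (ascending reps)
  ascending-complete v []         []       = []
  ascending-complete v (t ∷ reps) (p ∷ ps) = Allₚ.++⁺ (Allₚ.map⁺ p) (ascending-complete v reps ps)

  K : ℕ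
  K = width N

  ts : List GTerm
  ts = groundTerms N

  module Uniform (ws : List Carrier) (sorted : AllPairs _<_ ws) (reps-consts : Representatives constI) where
    open Representatives reps-consts renaming (size to k)

    m : ℕ
    m = length ws

    -- One index for each possible code: `m` thresholds give `suc (double m)` positions, each with a
    -- block of length `K`.
    M : ℕ
    M = suc (double m) ℕ.* K

    sorted′ : AllPairs _<_ (floor ws ∷ ws)
    sorted′ = floor-sorted sorted

    holdsAt : (p : Fin (nPred σ)) → List Carrier → List S → Bool
    holdsAt p rs ss = truth (predI p (build {Dom = sortDom S} 0r inhabit (arity σ p) rs ss))

    -- Positions and free arguments are fixed, only the indices vary. This leaves finitely many
    -- colourings, which can be made homogeneous together.
    colour : (p : Fin (nPred σ)) → List ℕ → List (Fin (suc k)) → List ℕ → Bool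
    colour p ps fs is = holdsAt p (zipWith (sample (floor ws) ws) ps is) (map element fs)

    colours : List (ℕ × (List ℕ → Bool))
    colours = concatMap (λ p → cartesianProductWith (λ ps fs → baseArity (arity σ p) , colour p ps fs)
                                 (listsOf (baseArity (arity σ p)) (upTo (suc (double m)))) (listsOf (freeArity (arity σ p)) (allFin (suc k))))
                        (allFin (nPred σ))

    colour∈ : ∀ p ps fs → length ps ≡ baseArity (arity σ p) → length fs ≡ freeArity (arity σ p) → All (ℕ._≤ double m) ps →
              (baseArity (arity σ p) , colour p ps fs) ∈ colours
    colour∈ p ps fs lp lf bounded = ∈-concatMap _ (∈-allFin p) (∈-cartesianProductWith⁺ (λ ps fs → baseArity (arity σ p) , colour p ps fs)
      (subst (λ n → ps ∈ listsOf n (upTo (suc (double m)))) lp (∈-listsOf⁺ (All.map (λ q → ∈-upTo⁺ (s≤s q)) bounded)))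
      (subst (λ n → fs ∈ listsOf n (allFin (suc k))) lf (∈-listsOf⁺ (All.tabulate (λ {f} _ → ∈-allFin f)))))

    module Sampled (h : ℕ → ℕ) (h-mono : ∀ {i j} → i ℕ.< j → j ℕ.< M → h i ℕ.< h j)
      (invariant : ∀ {n Q} → (n , Q) ∈ colours → ∀ ps → length ps ≡ n → All (λ u → proj₁ u ℕ.< M × proj₂ u ℕ.< M) ps →
         OrderEquivalent ps → Q (map (h ∘ proj₁) ps) ≡ Q (map (h ∘ proj₂) ps)) where

      h-cmp : ∀ {i j} → i ℕ.< M → j ℕ.< M → cmpℕ (h i) (h j) ≡ cmpℕ i j
      h-cmp {i} {j} i<M j<M with cmpℕ i j in e
      ... | less    = ℕᶜ.<⇒less (h-mono (ℕᶜ.less⇒< e) j<M)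
      ... | equal   = ℕᶜ.≡⇒equal (cong h (ℕᶜ.equal⇒≡ e))
      ... | greater = ℕᶜ.>⇒greater (h-mono (ℕᶜ.greater⇒> e) i<M)

      -- The index within the gap is the member of the homogeneous set numbered by the code, so that
      -- different positions use different blocks.
      val : Elt → Carrier
      val d = sample (floor ws) ws (proj₁ d) (h (flat K d))

      InRange : Elt → Set
      InRange d = proj₁ d ℕ.≤ double m × proj₂ d ℕ.< K

      val-position : ∀ d → InRange d → position ws (val d) ≡ proj₁ d
      val-position d (p≤ , _) = position-sample sorted′ p≤ (h (flat K d))

      -- In a common gap both codes lie in one block, where `flat`, `h` and `sample` all preserve
      -- the order of the indices.
      val-cmp : ∀ d e → InRange d → InRange e → cmpℕ (flat K d) (flat K e) ≡ cmp (val d) (val e)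
      val-cmp d@(p , i) e@(q , j) d∈@(p≤ , i<K) e∈@(q≤ , j<K) = trans
        (cong₂ (λ p q → cmpℕ (flat K (p , i)) (flat K (q , j))) (sym (val-position d d∈)) (sym (val-position e e∈)))
        (cmp-flat ws i<K j<K λ same ev →
          sameGap (trans (sym (val-position d d∈)) (trans same (val-position e e∈))) (trans (cong even (sym (val-position d d∈))) ev))
        where
        sameGap : p ≡ q → even p ≡ true → cmpℕ i j ≡ cmp (val (p , i)) (val (q , j))
        sameGap refl ev = sym (trans (sample-cmp sorted′ p ev (h (flat K (p , i))) (h (flat K (p , j))))
          (trans (h-cmp (flat-bound p≤ i<K) (flat-bound p≤ j<K)) (flat-even p i j ev)))

      -- Each entry is read off at a single tuple of sample points; that it is right for every tuple
      -- of samples with this key is `table-truth`.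
      valueTable : Key k → Bool
      valueTable (p , ds , fs) = holdsAt p (map val ds) (map element fs)

      module Assignment {ρ : GTerm → ℕ} (constant′ : Fin (nConst σ) → Fin (suc k)) (constant′≡ : ∀ c → element (constant′ c) ≡ constI c)
        (table : Key k → Bool) (table≡ : ∀ {κ} → κ ∈ keys m K k → table κ ≡ valueTable κ)
        (represents : ∀ {t} → t ∈ ts → ρ t ℕ.< m × nth 0r ws (ρ t) ≡ evalG 𝒜 t)
        (Λ : List Constraint) (Γ Δ : List (Atom σ)) (C∈ : (Λ ‖ Γ ⇒ Δ) ∈ N)
        (fb : ℕ → Elt) (ff : ℕ → Fin (suc k)) (fb∈ : ∀ {x} → x ∈ baseVars (Λ ‖ Γ ⇒ Δ) → InRange (fb x)) where

        open Evaluation K ρ k constant′ table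

        xs : List ℕ
        xs = baseVars (Λ ‖ Γ ⇒ Δ)

        βb : ℕ → Carrier
        βb = val ∘ fb

        βf : ℕ → S
        βf = element ∘ ff

        agrees : ∀ {x y} → x ∈ xs → y ∈ xs → cmpℕ (flat K (fb x)) (flat K (fb y)) ≡ cmp (βb x) (βb y)
        agrees {x} {y} x∈ y∈ = val-cmp (fb x) (fb y) (fb∈ x∈) (fb∈ y∈)

        located : ∀ {x} → x ∈ xs → proj₁ (fb x) ≡ position ws (βb x) × proj₂ (fb x) ℕ.< K
        located {x} x∈ = sym (val-position (fb x) (fb∈ x∈)) , proj₂ (fb∈ x∈)

        term≡ : ∀ t → element (term fb ff t) ≡ evalF 𝒜 βb βf t
        term≡ (fvar x)   = refl
        term≡ (fconst c) = constant′≡ c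

        module Predicate (p : Fin (nPred σ)) (as : All (Arg σ) (arity σ p)) (as⊆ : ∀ {x} → x ∈ bases as → x ∈ xs) where

          zs : List ℕ
          zs = bases as

          -- The arguments as the key records them: same positions, but indices replaced by ranks
          -- within the atom. The points change, their comparisons do not.
          ranked : ℕ → Elt
          ranked x = proj₁ (fb x) , rank (λ x y → fb x ≶ₑ fb y) zs x

          ranked-range : ∀ {x} → x ∈ zs → InRange (ranked x)
          ranked-range {x} x∈ = proj₁ (fb∈ (as⊆ x∈)) , ℕₚ.≤-<-trans (rank≤length _ zs x)
            (subst (ℕ._< K) (sym (length-bases as)) (arity<width σ N p))

          ranked-cmp : ∀ {x y} → x ∈ zs → y ∈ zs → cmpℕ (flat K (ranked x)) (flat K (ranked y)) ≡ cmp (βb x) (βb y)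
          ranked-cmp {x} {y} x∈ y∈ = trans
            (cong₂ (λ p q → cmpℕ (flat K (p , proj₂ (ranked x))) (flat K (q , proj₂ (ranked y))))
              (proj₁ (located (as⊆ x∈))) (proj₁ (located (as⊆ y∈))))
            (cmp-flat ws (proj₂ (ranked-range x∈)) (proj₂ (ranked-range y∈)) λ _ _ →
              trans (cong₂ cmpℕ (rank-real x∈) (rank-real y∈)) (RankComparing.cmp-rank isStrictTotalOrder βb x∈ y∈))
            where
            rank-real : ∀ {x} → x ∈ zs → rank (λ x y → fb x ≶ₑ fb y) zs x ≡ rank (λ x y → cmp (βb x) (βb y)) zs x
            rank-real x∈ = rank-cong zs (λ y∈ → agrees (as⊆ y∈) (as⊆ x∈))

          key∈ : key fb ff p as ∈ keys m K k
          key∈ = ∈-concatMap _ (∈-allFin p) (∈-map⁺ (p ,_) (∈-cartesianProduct⁺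
            (subst (λ n → canon (proj₁ ∘ fb) (λ x y → fb x ≶ₑ fb y) zs ∈ listsOf n (elements m K))
              (trans (Listₚ.length-map _ zs) (length-bases as))
              (∈-listsOf⁺ (Allₚ.map⁺ (All.tabulate λ x∈ → ∈-elements (proj₁ (ranked-range x∈)) (proj₂ (ranked-range x∈))))))
            (subst (λ n → map (term fb ff) (frees as) ∈ listsOf n (allFin (suc k)))
              (trans (Listₚ.length-map _ (frees as)) (length-frees as))
              (∈-listsOf⁺ (All.tabulate (λ {f} _ → ∈-allFin f))))))

          pairs : List (ℕ × ℕ)
          pairs = map (λ x → flat K (fb x) , flat K (ranked x)) zs

          pairs-equivalent : OrderEquivalent pairs
          pairs-equivalent u∈ v∈ with ∈-map⁻ (λ x → flat K (fb x) , flat K (ranked x)) u∈ | ∈-map⁻ (λ x → flat K (fb x) , flat K (ranked x)) v∈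
          ... | x , x∈ , refl | y , y∈ , refl = trans (agrees (as⊆ x∈) (as⊆ y∈)) (sym (ranked-cmp x∈ y∈))

          poss : List ℕ
          poss = map (proj₁ ∘ fb) zs

          fs : List (Fin (suc k))
          fs = map (term fb ff) (frees as)

          sampled₁ : zipWith (sample (floor ws) ws) poss (map (h ∘ proj₁) pairs) ≡ map βb zs
          sampled₁ = trans (cong (zipWith (sample (floor ws) ws) poss) (sym (Listₚ.map-∘ zs)))
            (zipWith-map (sample (floor ws) ws) (proj₁ ∘ fb) (λ x → h (flat K (fb x))) zs)

          sampled₂ : zipWith (sample (floor ws) ws) poss (map (h ∘ proj₂) pairs) ≡ map val (map ranked zs)
          sampled₂ = trans (cong (zipWith (sample (floor ws) ws) poss) (sym (Listₚ.map-∘ zs)))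
            (trans (zipWith-map (sample (floor ws) ws) (proj₁ ∘ fb) (λ x → h (flat K (ranked x))) zs) (Listₚ.map-∘ zs))

          colour-invariant : colour p poss fs (map (h ∘ proj₁) pairs) ≡ colour p poss fs (map (h ∘ proj₂) pairs)
          colour-invariant = invariant
            (colour∈ p poss fs (trans (Listₚ.length-map _ zs) (length-bases as)) (trans (Listₚ.length-map _ (frees as)) (length-frees as))
              (Allₚ.map⁺ (All.tabulate λ x∈ → proj₁ (ranked-range x∈))))
            pairs (trans (Listₚ.length-map _ zs) (length-bases as))
            (Allₚ.map⁺ (All.tabulate λ x∈ → flat-bound (proj₁ (fb∈ (as⊆ x∈))) (proj₂ (fb∈ (as⊆ x∈))) ,
                                             flat-bound (proj₁ (ranked-range x∈)) (proj₂ (ranked-range x∈))))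
            pairs-equivalent

          arguments : build {Dom = sortDom S} 0r inhabit (arity σ p) (map βb zs) (map element fs) ≡ evalArgs 𝒜 βb βf as
          arguments = trans (cong₂ (build {Dom = sortDom S} 0r inhabit (arity σ p)) (sym (bases-evalArgs βb βf as))
              (trans (sym (Listₚ.map-∘ (frees as))) (trans (Listₚ.map-cong term≡ (frees as)) (sym (frees-evalArgs βb βf as)))))
            (build-split 0r inhabit (evalArgs 𝒜 βb βf as))

          -- The table was filled at the points `val (ranked x)`, while the clause is evaluated at
          -- the points `val (fb x)`. Their codes form order-equivalent tuples below `M`, and
          -- positions and free arguments coincide, so the homogeneous colouring does not tell them
          -- apart.
          table-truth : table (key fb ff p as) ≡ truth (predI p (evalArgs 𝒜 βb βf as))
          table-truth = begin
            table (key fb ff p as)                           ≡⟨ table≡ key∈ ⟩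
            holdsAt p (map val (map ranked zs)) (map element fs) ≡⟨ cong (λ rs → holdsAt p rs (map element fs)) (sym sampled₂) ⟩
            colour p poss fs (map (h ∘ proj₂) pairs)         ≡⟨ sym colour-invariant ⟩
            colour p poss fs (map (h ∘ proj₁) pairs)         ≡⟨ cong (λ rs → holdsAt p rs (map element fs)) sampled₁ ⟩
            holdsAt p (map βb zs) (map element fs)           ≡⟨ cong (λ as → truth (predI p as)) arguments ⟩
            truth (predI p (evalArgs 𝒜 βb βf as))            ∎
            where open ≡-Reasoning

        var∈ : ∀ {p as x} → pred p as ∈ Γ ++ Δ → x ∈ bases as → x ∈ xs
        var∈ a∈ x∈ = ∈-++⁺ʳ (concatMap constraintVars Λ) (∈-concatMap atomBases a∈ x∈)

        atom-sound : ∀ a → a ∈ Γ ++ Δ → atomᵇ fb ff a ≡ true → ¬ ¬ evalA 𝒜 βb βf a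
        atom-sound (s ≈ₐ t)    a∈ h ¬a = ¬a (trans (sym (term≡ s))
          (trans (cong element (does-true (term fb ff s Fin.≟ term fb ff t) h)) (term≡ t)))
        atom-sound (pred p as) a∈ h = truth-sound (trans (sym (Predicate.table-truth p as (var∈ a∈))) h)

        atom-complete : ∀ a → a ∈ Γ ++ Δ → evalA 𝒜 βb βf a → atomᵇ fb ff a ≡ true
        atom-complete (s ≈ₐ t)    a∈ h = dec-true (term fb ff s Fin.≟ term fb ff t)
          (injective (trans (term≡ s) (trans h (sym (term≡ t)))))
        atom-complete (pred p as) a∈ h = trans (Predicate.table-truth p as (var∈ a∈)) (truth-complete h)

        constraints : all (constraintᵇ fb ff) Λ ≡ true → All (evalC 𝒜 βb βf) Λ
        constraints hΛ = All.tabulate λ {c} c∈ → Agreement.constraint-sound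
          (s≤s z≤n) sorted represents {constant = constant′} {table = table} {βf = βf} {ff = ff} located agrees c
          (All.tabulate λ x∈ → ∈-++⁺ˡ (∈-concatMap constraintVars c∈ x∈))
          (All.tabulate λ t∈ → ∈-concatMap (concatMap constraintTerms ∘ Clause.Λ) C∈ (∈-concatMap constraintTerms c∈ t∈))
          (All.lookup (all-true⇒All Λ hΛ) c∈)

        -- `atom-sound` gives the premises in `Γ` only under double negation. They are finitely many
        -- and the goal is a stable equation between Booleans, so they may be used as if they held.
        -- Constraints hold outright because the order is decidable.
        conclusion : ModelOfClause 𝒜 (Λ ‖ Γ ⇒ Δ) → all (constraintᵇ fb ff) Λ ≡ true → all (atomᵇ fb ff) Γ ≡ true → any (atomᵇ fb ff) Δ ≡ true
        conclusion model hΛ hΓ = decidable-stable (any (atomᵇ fb ff) Δ Bool.≟ true) λ ¬Δ →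
          ¬¬-All Γ (λ {a} a∈ → atom-sound a (∈-++⁺ˡ a∈) (All.lookup (all-true⇒All Γ hΓ) a∈)) λ hΓ′ →
            let a , a∈ , ha = find (model βb βf (constraints hΛ) hΓ′)
            in ¬Δ (∃⇒any-true a∈ (atom-complete a (∈-++⁺ʳ Γ a∈) ha))

        clause-true : ModelOfClause 𝒜 (Λ ‖ Γ ⇒ Δ) → clauseᵇ fb ff (Λ ‖ Γ ⇒ Δ) ≡ true
        clause-true model = implication (all (constraintᵇ fb ff) Λ) (all (atomᵇ fb ff) Γ) (conclusion model)
          where
          implication : ∀ a b {c} → (a ≡ true → b ≡ true → c ≡ true) → (if a ∧ b then c else true) ≡ true
          implication true  true  h = h refl refl
          implication true  false h = refl
          implication false b     h = refl

      uniform : Model 𝒜 N → ∀ ρ → (∀ {t} → t ∈ ts → ρ t ℕ.< m × nth 0r ws (ρ t) ≡ evalG 𝒜 t) → uniformModelExists N ρ m ≡ true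
      uniform model ρ represents =
        let constant′ , constant′∈ , constant′≡ =
              FunConst.functions-complete (nConst σ) k (allFin (nConst σ)) constant (λ {c} _ → ∈-allFin (constant c))
            table , table∈ , table≡ =
              FunKey.functions-complete k (keys m K k) valueTable (λ {κ} _ → bool-∈ (valueTable κ))
        in ∃⇒any-true (∈-upTo⁺ (s≤s size≤)) (∃⇒any-true constant′∈ (∃⇒any-true table∈ (All⇒all-true (All.tabulate λ {C} C∈ →
             checked C C∈ constant′ (λ c → trans (cong element (constant′≡ (∈-allFin c))) (constant≡ c)) table table≡))))
        where
        checked : ∀ C → C ∈ N → ∀ constant′ → (∀ c → element (constant′ c) ≡ constI c) →
                  ∀ table → (∀ {κ} → κ ∈ keys m K k → table κ ≡ valueTable κ) → Evaluation.check K ρ k constant′ table m C ≡ true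
        checked C@(Λ ‖ Γ ⇒ Δ) C∈ constant′ constant′≡ table table≡ =
          All⇒all-true (All.tabulate λ {fb} fb∈ → All⇒all-true {xs = FunFree.functions k (freeVars C) (allFin (suc k))} (All.tabulate λ {ff} _ →
            Assignment.clause-true constant′ constant′≡ table table≡ represents Λ Γ Δ C∈ fb ff
              (λ {x} x∈ → elements-bound (fb x) (FunElt.functions-range (baseVars C) fb∈ x∈)) (All.lookup model C∈)))

    uniform-exists : Model 𝒜 N → ∀ ρ → (∀ {t} → t ∈ ts → ρ t ℕ.< m × nth 0r ws (ρ t) ≡ evalG 𝒜 t) → uniformModelExists N ρ m ≡ true
    uniform-exists = let h , h-mono , invariant = tupleRamsey colours M in Sampled.uniform h h-mono invariant

  conclude : Representatives constI → Model 𝒜 N → decide N ≡ true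
  conclude r model =
    -- The guess for the search to hit is the actual order in the model: each ground term is sent to
    -- the place of its value among the thresholds.
    let ρ , ρ∈ , ρ≡ = FunGTerm.functions-complete ts {upTo (length reps)} (indexOf ws ∘ value)
                        (λ {t} t∈ → ∈-upTo⁺ (subst (indexOf ws (value t) ℕ.<_) (Listₚ.length-map value reps) (proj₁ (indexOf-spec (covers t∈)))))
        represents : ∀ {t} → t ∈ ts → ρ t ℕ.< length ws × nth 0r ws (ρ t) ≡ evalG 𝒜 t
        represents {t} t∈ = subst (λ i → i ℕ.< length ws × nth 0r ws i ≡ evalG 𝒜 t) (sym (ρ≡ t∈))
          (proj₁ (indexOf-spec (covers t∈)) , trans (proj₂ (indexOf-spec (covers t∈))) (sym (evalG≡evalTerm t)))
        rep≡ : ∀ {t} → t ∈ ts → value (rep reps ρ t) ≡ value t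
        rep≡ {t} t∈ = trans (sym (nth-map value (num 0ℚ) 0r reps (∈-upTo⁻ (FunGTerm.functions-range ts ρ∈ t∈))))
          (trans (proj₂ (represents t∈)) (evalG≡evalTerm t))
    in ∃⇒any-true (∈-concatMap (λ n → listsOf n ts) (∈-upTo⁺ (s≤s short)) (∈-listsOf⁺ (All.tabulate reps⊆)))
         (∃⇒any-true ρ∈ (true-∧
           (feasible-complete (comparisons ts reps ρ) skolemI (Allₚ.++⁺ (ascending-complete skolemI reps increasing)
             (Allₚ.concat⁺ (Allₚ.map⁺ (All.tabulate λ t∈ → inj₂ (sym (rep≡ t∈)) ∷ inj₂ (rep≡ t∈) ∷ [])))))
           (subst (λ n → uniformModelExists N ρ n ≡ true) (Listₚ.length-map value reps)
             (Uniform.uniform-exists ws (AllPairsₚ.map⁺ increasing) r model ρ represents))))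
    where
    value : GTerm → Carrier
    value = evalTerm skolemI
    open Ordering (order value ts)
    ws : List Carrier
    ws = map value reps

theorem1 : Σ ((σ : Signature) → List (Clause σ) → Bool)
    (λ decide → (R : RealField) (σ : Signature) (N : List (Clause σ)) →
    (decide σ N ≡ true) ⇔ Semantics.Satisfiable R σ N)
theorem1 = Procedure.decide , λ R σ N → mk⇔ (Soundness.sound R σ N) λ (𝒜 , model) →
  -- Representatives of the constants exist only up to double negation, which a Boolean verdict
  -- absorbs.
  decidable-stable (Procedure.decide σ N Bool.≟ true) λ ¬decided →
    representatives (Semantics.Interpretation.inhabit 𝒜) (nConst σ) (Semantics.Interpretation.constI 𝒜) λ r →
      ¬decided (Completeness.conclude R σ 𝒜 N r model)
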